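{- Fix $\alpha \in (1/2, 1)$ and $\varepsilon>0$. Then there exists $n_0$ such that the following holds for all $n>n_0$: every $n$-vertex graph $G$ with at least $\lfloor n^2/4\rfloor+1$ edges and $b(G)<\alpha n/2$ satisfies $$t(G) > (\alpha(1-\alpha)-\varepsilon) \frac{n^2}{4}.$$
   Context: Graphs are finite and simple. A book of size $b$ in a graph is an edge that lies in $b$ triangles; $b(G)$ denotes the maximum size of a book in $G$, i.e. the maximum, over all edges $e$ of $G$, of the number of triangles of $G$ containing $e$. $t(G)$ denotes the number of triangles in $G$. -}

module Defs where

open import Data.Fin.Base as Fin using (Fin)
import Data.Fin.Properties as Fin
open import Data.Integer.Base using (+_)
open import Data.List.Base using (List; allFin; cartesianProduct; filter; length; map)
open import Data.List.Extrema.Nat using (max)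
open import Data.Nat.Base as ℕ using (ℕ)
import Data.Nat.Properties as ℕ
open import Data.Product.Base using (_×_; _,_; ∃-syntax; proj₁; proj₂)
open import Data.Rational.Base
import Data.Rational.Properties as ℚ
open import Data.Rational.Solver using (module +-*-Solver)
open import Data.Sum.Base using (_⊎_)
open import Level using (0ℓ)
open import Relation.Binary.Core using (Rel)
open import Relation.Binary.Definitions using (Decidable; Symmetric; Irreflexive)
open import Relation.Binary.PropositionalEquality
open import Relation.Nullary.Decidable using (_×-dec_; _⊎-dec_)
import Relation.Unary as U

-- Real numbers: Cauchy sequences of rationals, each carrying a modulus of
-- convergence.  Equality of reals is not needed below, so no setoid is defined.

IsCauchy : (ℕ → ℚ) → Set
IsCauchy x = ∀ ε → 0ℚ < ε →
  ∃[ N ] (∀ m n → N ℕ.≤ m → N ℕ.≤ n → ∣ x m - x n ∣ < ε)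

record ℝ : Set where
  constructor mkℝ
  field
    seq    : ℕ → ℚ
    cauchy : IsCauchy seq

open ℝ public

private
  half-pos : ∀ {ε} → 0ℚ < ε → 0ℚ < ½ * ε
  half-pos {ε} 0<ε = subst (_< ½ * ε) (ℚ.*-zeroʳ ½) (ℚ.*-monoʳ-<-pos ½ 0<ε)

  halves : ∀ ε → ½ * ε + ½ * ε ≡ ε
  halves = solve 1 (λ e → con ½ :* e :+ con ½ :* e := e) refl
    where open +-*-Solver

  const-cauchy : ∀ q → IsCauchy (λ _ → q)
  const-cauchy q ε 0<ε = 0 , λ _ _ _ _ →
    subst (_< ε) (sym (cong ∣_∣ (ℚ.+-inverseʳ q))) 0<ε

  +-cauchy : ∀ x y → IsCauchy x → IsCauchy y → IsCauchy (λ n → x n + y n)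
  +-cauchy x y cx cy ε 0<ε = Nx ℕ.⊔ Ny , close
    where
    Nx = proj₁ (cx (½ * ε) (half-pos 0<ε))
    Ny = proj₁ (cy (½ * ε) (half-pos 0<ε))

    rearrange : ∀ a b c d → (a + b) - (c + d) ≡ (a - c) + (b - d)
    rearrange = solve 4 (λ a b c d →
      (a :+ b) :- (c :+ d) := (a :- c) :+ (b :- d)) refl
      where open +-*-Solver

    close : ∀ m n → Nx ℕ.⊔ Ny ℕ.≤ m → Nx ℕ.⊔ Ny ℕ.≤ n →
            ∣ (x m + y m) - (x n + y n) ∣ < ε
    close m n N≤m N≤n = begin-strict
      ∣ (x m + y m) - (x n + y n) ∣     ≡⟨ cong ∣_∣ (rearrange (x m) (y m) (x n) (y n)) ⟩
      ∣ (x m - x n) + (y m - y n) ∣     ≤⟨ ℚ.∣p+q∣≤∣p∣+∣q∣ (x m - x n) (y m - y n) ⟩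
      ∣ x m - x n ∣ + ∣ y m - y n ∣     <⟨ ℚ.+-mono-<
        (proj₂ (cx (½ * ε) (half-pos 0<ε)) m n
          (ℕ.m⊔n≤o⇒m≤o Nx Ny N≤m) (ℕ.m⊔n≤o⇒m≤o Nx Ny N≤n))
        (proj₂ (cy (½ * ε) (half-pos 0<ε)) m n
          (ℕ.m⊔n≤o⇒n≤o Nx Ny N≤m) (ℕ.m⊔n≤o⇒n≤o Nx Ny N≤n)) ⟩
      ½ * ε + ½ * ε                     ≡⟨ halves ε ⟩
      ε                                 ∎
      where open ℚ.≤-Reasoning

  neg-cauchy : ∀ x → IsCauchy x → IsCauchy (λ n → - x n)
  neg-cauchy x cx ε 0<ε = proj₁ (cx ε 0<ε) , λ m n N≤m N≤n →
    subst (_< ε)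
      (trans (sym (ℚ.∣-p∣≡∣p∣ (x m - x n)))
             (cong ∣_∣ (ℚ.neg-distrib-+ (x m) (- x n))))
      (proj₂ (cx ε 0<ε) m n N≤m N≤n)

  EventuallyBounded : (ℕ → ℚ) → Set
  EventuallyBounded x =
    ∃[ B ] Positive B × ∃[ N ] (∀ n → N ℕ.≤ n → ∣ x n ∣ ≤ B)

  bounded : ∀ x → IsCauchy x → EventuallyBounded x
  bounded x cx = B , positiveB , N , bound
    where
    0<1 = ℚ.positive⁻¹ 1ℚ
    N   = proj₁ (cx 1ℚ 0<1)
    B   = 1ℚ + ∣ x N ∣

    positiveB : Positive B
    positiveB = positive (ℚ.+-mono-<-≤ 0<1 (ℚ.0≤∣p∣ (x N)))

    split : ∀ a b → a ≡ (a - b) + b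
    split = solve 2 (λ a b → a := (a :- b) :+ b) refl
      where open +-*-Solver

    bound : ∀ n → N ℕ.≤ n → ∣ x n ∣ ≤ B
    bound n N≤n = begin
      ∣ x n ∣                       ≡⟨ cong ∣_∣ (split (x n) (x N)) ⟩
      ∣ (x n - x N) + x N ∣         ≤⟨ ℚ.∣p+q∣≤∣p∣+∣q∣ (x n - x N) (x N) ⟩
      ∣ x n - x N ∣ + ∣ x N ∣       ≤⟨ ℚ.+-monoˡ-≤ ∣ x N ∣
        (ℚ.<⇒≤ (proj₂ (cx 1ℚ 0<1) n N N≤n ℕ.≤-refl)) ⟩
      B                             ∎
      where open ℚ.≤-Reasoning

  *-cauchy : ∀ x y → EventuallyBounded x → EventuallyBounded y →
             IsCauchy x → IsCauchy y → IsCauchy (λ n → x n * y n)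
  *-cauchy x y (Bx , posBx , Mx , boundx) (By , posBy , My , boundy)
           cx cy ε 0<ε = N , close
    where
    instance
      _ = posBx
      _ = posBy
      nzx = ℚ.pos⇒nonZero Bx
      nzy = ℚ.pos⇒nonZero By
      pos½ε = positive (half-pos 0<ε)
      pos1/Bx = ℚ.1/pos⇒pos Bx
      pos1/By = ℚ.1/pos⇒pos By

    δx = ½ * ε * 1/ By
    δy = ½ * ε * 1/ Bx

    0<δx : 0ℚ < δx
    0<δx = ℚ.positive⁻¹ δx {{ℚ.pos*pos⇒pos (½ * ε) (1/ By)}}

    0<δy : 0ℚ < δy
    0<δy = ℚ.positive⁻¹ δy {{ℚ.pos*pos⇒pos (½ * ε) (1/ Bx)}}

    Nx = proj₁ (cx δx 0<δx)
    Ny = proj₁ (cy δy 0<δy)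
    N  = (Mx ℕ.⊔ My) ℕ.⊔ (Nx ℕ.⊔ Ny)

    rearrange : ∀ a b c d → a * b - c * d ≡ a * (b - d) + d * (a - c)
    rearrange = solve 4 (λ a b c d →
      a :* b :- c :* d := a :* (b :- d) :+ d :* (a :- c)) refl
      where open +-*-Solver

    term : ∀ {p q} B .{{_ : Positive B}} .{{_ : NonZero B}} →
           ∣ p ∣ ≤ B → ∣ q ∣ < ½ * ε * 1/ B → ∣ p * q ∣ < ½ * ε
    term {p} {q} B p≤B q<δ = begin-strict
      ∣ p * q ∣                ≡⟨ ℚ.∣p*q∣≡∣p∣*∣q∣ p q ⟩
      ∣ p ∣ * ∣ q ∣            ≤⟨ ℚ.*-monoʳ-≤-nonNeg ∣ q ∣ {{ℚ.∣-∣-nonNeg q}} p≤B ⟩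
      B * ∣ q ∣                <⟨ ℚ.*-monoʳ-<-pos B q<δ ⟩
      B * (½ * ε * 1/ B)       ≡⟨ ℚ.*-comm B _ ⟩
      ½ * ε * 1/ B * B         ≡⟨ ℚ.*-assoc (½ * ε) (1/ B) B ⟩
      ½ * ε * (1/ B * B)       ≡⟨ cong (½ * ε *_) (ℚ.*-inverseˡ B) ⟩
      ½ * ε * 1ℚ               ≡⟨ ℚ.*-identityʳ (½ * ε) ⟩
      ½ * ε                    ∎
      where open ℚ.≤-Reasoning

    close : ∀ m n → N ℕ.≤ m → N ℕ.≤ n → ∣ x m * y m - x n * y n ∣ < ε
    close m n N≤m N≤n = begin-strict
      ∣ x m * y m - x n * y n ∣                       ≡⟨ cong ∣_∣ (rearrange (x m) (y m) (x n) (y n)) ⟩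
      ∣ x m * (y m - y n) + y n * (x m - x n) ∣       ≤⟨ ℚ.∣p+q∣≤∣p∣+∣q∣ (x m * (y m - y n)) (y n * (x m - x n)) ⟩
      ∣ x m * (y m - y n) ∣ + ∣ y n * (x m - x n) ∣   <⟨ ℚ.+-mono-<
        (term Bx (boundx m (≤Mx N≤m)) (proj₂ (cy δy 0<δy) m n (≤Ny N≤m) (≤Ny N≤n)))
        (term By (boundy n (≤My N≤n)) (proj₂ (cx δx 0<δx) m n (≤Nx N≤m) (≤Nx N≤n))) ⟩
      ½ * ε + ½ * ε                                   ≡⟨ halves ε ⟩
      ε                                               ∎
      where
      open ℚ.≤-Reasoning
      module _ {k} (N≤k : N ℕ.≤ k) where
        ≤M = ℕ.m⊔n≤o⇒m≤o (Mx ℕ.⊔ My) (Nx ℕ.⊔ Ny) N≤k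
        ≤N = ℕ.m⊔n≤o⇒n≤o (Mx ℕ.⊔ My) (Nx ℕ.⊔ Ny) N≤k
        ≤Mx = ℕ.m⊔n≤o⇒m≤o Mx My ≤M
        ≤My = ℕ.m⊔n≤o⇒n≤o Mx My ≤M
        ≤Nx = ℕ.m⊔n≤o⇒m≤o Nx Ny ≤N
        ≤Ny = ℕ.m⊔n≤o⇒n≤o Nx Ny ≤N

infixl 6 _+ℝ_ _-ℝ_
infixl 7 _*ℝ_
infix  8 -ℝ_
infix  4 _<ℝ_ _>ℝ_

fromℚ : ℚ → ℝ
fromℚ q = mkℝ (λ _ → q) (const-cauchy q)

fromℕ : ℕ → ℝ
fromℕ n = fromℚ (+ n / 1)

_+ℝ_ : ℝ → ℝ → ℝ
x +ℝ y = mkℝ (λ n → seq x n + seq y n) (+-cauchy (seq x) (seq y) (cauchy x) (cauchy y))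

-ℝ_ : ℝ → ℝ
-ℝ x = mkℝ (λ n → - seq x n) (neg-cauchy (seq x) (cauchy x))

_-ℝ_ : ℝ → ℝ → ℝ
x -ℝ y = x +ℝ (-ℝ y)

_*ℝ_ : ℝ → ℝ → ℝ
x *ℝ y = mkℝ (λ n → seq x n * seq y n)
  (*-cauchy (seq x) (seq y) (bounded (seq x) (cauchy x)) (bounded (seq y) (cauchy y))
            (cauchy x) (cauchy y))

-- The positive rational gap is needed: termwise strict inequality of the
-- approximations would only give ≤ in the limit.
_<ℝ_ : ℝ → ℝ → Set
x <ℝ y = ∃[ δ ] 0ℚ < δ × ∃[ N ] (∀ n → N ℕ.≤ n → seq x n + δ ≤ seq y n)

_>ℝ_ : ℝ → ℝ → Set
x >ℝ y = y <ℝ x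

record Graph (n : ℕ) : Set₁ where
  field
    _~_      : Rel (Fin n) 0ℓ
    _~?_     : Decidable _~_
    ~-sym    : Symmetric _~_
    ~-irrefl : Irreflexive _≡_ _~_

Pair Triple : ℕ → Set
Pair   n = Fin n × Fin n
Triple n = Fin n × Fin n × Fin n

_∈ᵗ_ : ∀ {n} → Fin n → Triple n → Set
v ∈ᵗ (i , j , k) = v ≡ i ⊎ v ≡ j ⊎ v ≡ k

Contains : ∀ {n} → Pair n → Triple n → Set
Contains (u , v) t = u ∈ᵗ t × v ∈ᵗ t

contains? : ∀ {n} (e : Pair n) → U.Decidable (Contains e)
contains? (u , v) (i , j , k) = mem? u ×-dec mem? v
  where mem? = λ w → (w Fin.≟ i) ⊎-dec (w Fin.≟ j) ⊎-dec (w Fin.≟ k)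

module _ {n : ℕ} (G : Graph n) where
  open Graph G

  -- Edges and triangles are listed with increasing vertices, so that each
  -- unordered one occurs exactly once.

  IsEdge : Pair n → Set
  IsEdge (i , j) = i Fin.< j × i ~ j

  isEdge? : U.Decidable IsEdge
  isEdge? (i , j) = (i Fin.<? j) ×-dec (i ~? j)

  IsTriangle : Triple n → Set
  IsTriangle (i , j , k) = IsEdge (i , j) × IsEdge (i , k) × IsEdge (j , k)

  isTriangle? : U.Decidable IsTriangle
  isTriangle? (i , j , k) = isEdge? (i , j) ×-dec isEdge? (i , k) ×-dec isEdge? (j , k)

  edges : List (Pair n)
  edges = filter isEdge? (cartesianProduct (allFin n) (allFin n))

  triangles : List (Triple n)
  triangles = filter isTriangle?
    (cartesianProduct (allFin n) (cartesianProduct (allFin n) (allFin n)))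

  edgeCount : ℕ
  edgeCount = length edges

  t : ℕ
  t = length triangles

  bookSize : Pair n → ℕ
  bookSize e = length (filter (contains? e) triangles)

  -- An edgeless graph gets book number 0.
  b : ℕ
  b = max 0 (map bookSize edges)

{-# OPTIONS --safe #-}

-- We may assume t(G) ≤ n²/16.  Averaging over the cuts (N(u), V \ N(u)), one of them has only O(n)
-- inner edges; moving vertices across, we get such a cut in which no vertex has more inner than
-- outer neighbours.  As there are more than n²/4 edges, its sides differ by O(√n) and there are
-- fewer missing cross edges than inner edges.  If b(G) < α n / 2, the ends of every inner edge miss
-- together at least (1 − α) n / 2 − O(√n) cross edges, so the few vertices missing many cross edges
-- cover the inner edges, and by counting one of them, v, has essentially at least as many inner
-- neighbours as missing cross edges.  Some inner neighbour of v misses few cross edges, hence v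
-- misses at least (1 − α) n / 2 − o(n) of them.  So v has p ≥ (1 − α) n / 2 − o(n) inner and q ≥ p
-- outer neighbours with p + q ≥ n / 2 − o(n), and nearly all p q pairs of these span triangles with v.

module Submission where

open import Defs
import Algebra.Properties.Semiring.Sum
open import Data.Bool.Base using (Bool; true; false; not; _∧_; _∨_; _xor_)
import Data.Bool.Properties as Bool
open import Data.Fin.Base as Fin using (Fin; zero; suc)
import Data.Fin.Properties as Fin
open import Data.List.Base using (List; []; _∷_; allFin; cartesianProduct; filter; length; map; tabulate; _++_)
import Data.List.Properties as List
open import Data.List.Extrema.Nat using (xs≤max)
open import Data.List.Membership.Propositional.Properties using (∈-filter⁺; ∈-cartesianProduct⁺; ∈-allFin; ∈-map⁺)
import Data.List.Relation.Unary.All as All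
open import Data.Nat.Base using (ℕ; zero; suc; _+_; _*_; _/_; _%_; _⊔_; _≤_; _<_; z≤n; s≤s; NonZero; >-nonZero)
open import Data.Nat.DivMod
open import Data.Nat.Properties
open import Data.Nat.Tactic.RingSolver using (solve-∀)
open import Data.Product.Base using (_×_; _,_; ∃-syntax; proj₁; proj₂)
open import Data.Sum.Base using (inj₁; inj₂; [_,_]′)
open import Function.Base using (_∘_; id)
open import Level using (Level)
open import Relation.Binary.Definitions using (Tri; tri<; tri≈; tri>)
open import Relation.Binary.PropositionalEquality
open import Relation.Nullary.Decidable using (Dec; yes; no; does; True; toWitness; dec-true; dec-false; _×-dec_; _→-dec_)
open import Relation.Nullary.Negation using (¬_; contradiction)
import Relation.Unary as U

-- Finite sums

open Algebra.Properties.Semiring.Sum +-*-semiring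
  using (sum; ∑-distrib-+; ∑-comm; *-distribˡ-sum; *-distribʳ-sum; sum-cong-≗)

private variable
  ℓ ℓ′ : Level
  A X Y : Set ℓ
  n : ℕ

-- Pointwise statements about indicators quantify over Booleans only; deciding these quantifiers
-- lets evaluation check every case.
∀-Bool? : {P : Bool → Set ℓ} → (∀ x → Dec (P x)) → Dec (∀ x → P x)
∀-Bool? P? with P? false | P? true
... | yes p | yes q = yes λ { false → p ; true → q }
... | no ¬p | _     = no λ f → ¬p (f false)
... | yes _ | no ¬q = no λ f → ¬q (f true)

⟦_⟧ : Bool → ℕ
⟦ false ⟧ = 0
⟦ true  ⟧ = 1

∑ : (Fin n → ℕ) → ℕ
∑ = sum

∑-cong : {f g : Fin n → ℕ} → (∀ i → f i ≡ g i) → ∑ f ≡ ∑ g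
∑-cong = sum-cong-≗

∑-mono : {f g : Fin n → ℕ} → (∀ i → f i ≤ g i) → ∑ f ≤ ∑ g
∑-mono {zero}  f≤g = z≤n
∑-mono {suc n} f≤g = +-mono-≤ (f≤g zero) (∑-mono (f≤g ∘ suc))

∑-zero : ∀ n → ∑ {n} (λ _ → 0) ≡ 0
∑-zero zero    = refl
∑-zero (suc n) = ∑-zero n

∑-const : ∀ n c → ∑ {n} (λ _ → c) ≡ n * c
∑-const zero    c = refl
∑-const (suc n) c = cong (c +_) (∑-const n c)

∑-+ : (f g : Fin n → ℕ) → ∑ (λ i → f i + g i) ≡ ∑ f + ∑ g
∑-+ = ∑-distrib-+

∑-*ˡ : ∀ c (f : Fin n → ℕ) → ∑ (λ i → c * f i) ≡ c * ∑ f
∑-*ˡ c f = sym (*-distribˡ-sum c f)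

∑-*ʳ : ∀ c (f : Fin n → ℕ) → ∑ (λ i → f i * c) ≡ ∑ f * c
∑-*ʳ c f = sym (*-distribʳ-sum c f)

∑-<⇒∃ : (f g : Fin n → ℕ) → ∑ f < ∑ g → ∃[ i ] f i < g i
∑-<⇒∃ {suc n} f g lt with f zero <? g zero
... | yes p = zero , p
... | no ¬p = let i , q = ∑-<⇒∃ (f ∘ suc) (g ∘ suc)
                            (+-cancelˡ-< (f zero) _ _
                              (<-≤-trans lt (+-monoˡ-≤ _ (≮⇒≥ ¬p))))
              in suc i , q

∑-≤⇒∃ : (f : Fin n → ℕ) (c : ℕ) → 0 < n → ∑ f ≤ n * c → ∃[ i ] f i ≤ c
∑-≤⇒∃ {n} f c 0<n ∑f≤nc =
  let i , p = ∑-<⇒∃ f (λ _ → suc c)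
                (≤-<-trans ∑f≤nc (subst (n * c <_) (sym (∑-const n (suc c)))
                  (*-monoʳ-< n {{>-nonZero 0<n}} ≤-refl)))
  in i , ≤-pred p

∑∑ : (Fin n → Fin n → ℕ) → ℕ
∑∑ f = ∑ λ i → ∑ (f i)

∑∑-mono : {f g : Fin n → Fin n → ℕ} → (∀ i j → f i j ≤ g i j) → ∑∑ f ≤ ∑∑ g
∑∑-mono f≤g = ∑-mono λ i → ∑-mono (f≤g i)

∑∑-cong : {f g : Fin n → Fin n → ℕ} → (∀ i j → f i j ≡ g i j) → ∑∑ f ≡ ∑∑ g
∑∑-cong f≡g = ∑-cong λ i → ∑-cong (f≡g i)

∑∑-+ : (f g : Fin n → Fin n → ℕ) → ∑∑ (λ i j → f i j + g i j) ≡ ∑∑ f + ∑∑ g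
∑∑-+ f g = trans (∑-cong λ i → ∑-+ (f i) (g i)) (∑-+ (∑ ∘ f) (∑ ∘ g))

∑∑-comm : (f : Fin n → Fin n → ℕ) → ∑∑ (λ i j → f j i) ≡ ∑∑ f
∑∑-comm f = ∑-comm (λ i j → f j i)

∑∑-*ˡ : ∀ c (f : Fin n → Fin n → ℕ) → ∑∑ (λ i j → c * f i j) ≡ c * ∑∑ f
∑∑-*ˡ c f = trans (∑-cong λ i → ∑-*ˡ c (f i)) (∑-*ˡ c (∑ ∘ f))

∑∑-* : (f g : Fin n → ℕ) → ∑∑ (λ i j → f i * g j) ≡ ∑ f * ∑ g
∑∑-* f g = trans (∑-cong λ i → ∑-*ˡ (f i) g) (∑-*ʳ (∑ g) f)

-- Boolean-valued, so that comparing two successors reduces to comparing their predecessors, on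
-- which the recursion in `∑-δ` relies.
δ : Fin n → Fin n → Bool
δ i j = does (i Fin.≟ j)

∑-δ : (v : Fin n) (f : Fin n → ℕ) → ∑ (λ i → ⟦ δ v i ⟧ * f i) ≡ f v
∑-δ {suc n} zero f = trans (cong₂ _+_ (*-identityˡ (f zero)) (∑-zero n)) (+-identityʳ (f zero))
∑-δ {suc n} (suc v) f = ∑-δ v (f ∘ suc)

∑∑-δˡ : (v : Fin n) (f : Fin n → Fin n → ℕ) → ∑∑ (λ i j → ⟦ δ v i ⟧ * f i j) ≡ ∑ (f v)
∑∑-δˡ v f = trans (∑-cong λ i → ∑-*ˡ ⟦ δ v i ⟧ (f i)) (∑-δ v (∑ ∘ f))

∑∑-δʳ : (v : Fin n) (f : Fin n → Fin n → ℕ) → ∑∑ (λ i j → ⟦ δ v j ⟧ * f i j) ≡ ∑ (λ i → f i v)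
∑∑-δʳ v f = ∑-cong λ i → ∑-δ v (f i)

-- Lengths of filtered lists as sums

length-filter-map : {P : U.Pred Y ℓ′} (P? : U.Decidable P) (f : X → Y) (xs : List X) →
  length (filter P? (map f xs)) ≡ length (filter (P? ∘ f) xs)
length-filter-map P? f [] = refl
length-filter-map P? f (x ∷ xs) with does (P? (f x))
... | true  = cong suc (length-filter-map P? f xs)
... | false = length-filter-map P? f xs

length-filter-filter : {P Q : U.Pred X ℓ} (P? : U.Decidable P) (Q? : U.Decidable Q) (xs : List X) →
  length (filter Q? (filter P? xs)) ≡ length (filter (λ x → P? x ×-dec Q? x) xs)
length-filter-filter P? Q? [] = refl
length-filter-filter P? Q? (x ∷ xs) with does (P? x)
... | false = length-filter-filter P? Q? xs
... | true with does (Q? x)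
...   | true  = cong suc (length-filter-filter P? Q? xs)
...   | false = length-filter-filter P? Q? xs

length-filter-tabulate : {P : U.Pred X ℓ} (P? : U.Decidable P) (f : Fin n → X) →
  length (filter P? (tabulate f)) ≡ ∑ (λ i → ⟦ does (P? (f i)) ⟧)
length-filter-tabulate {n = zero}  P? f = refl
length-filter-tabulate {n = suc n} P? f with does (P? (f zero))
... | true  = cong suc (length-filter-tabulate P? (f ∘ suc))
... | false = length-filter-tabulate P? (f ∘ suc)

length-filter-product : {P : U.Pred (X × Y) ℓ} (P? : U.Decidable P) (f : Fin n → X) (ys : List Y) →
  length (filter P? (cartesianProduct (tabulate f) ys)) ≡
  ∑ (λ i → length (filter (P? ∘ (f i ,_)) ys))
length-filter-product {n = zero}  P? f ys = refl
length-filter-product {n = suc n} P? f ys = begin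
  length (filter P? (map (f zero ,_) ys ++ rest))
    ≡⟨ cong length (List.filter-++ P? (map (f zero ,_) ys) rest) ⟩
  length (filter P? (map (f zero ,_) ys) ++ filter P? rest)
    ≡⟨ List.length-++ (filter P? (map (f zero ,_) ys)) ⟩
  length (filter P? (map (f zero ,_) ys)) + length (filter P? rest)
    ≡⟨ cong₂ _+_ (length-filter-map P? (f zero ,_) ys) (length-filter-product P? (f ∘ suc) ys) ⟩
  ∑ (λ i → length (filter (P? ∘ (f i ,_)) ys)) ∎
  where
  open ≡-Reasoning
  rest = cartesianProduct (tabulate (f ∘ suc)) ys

count-pairs : {P : U.Pred (Pair n) ℓ} (P? : U.Decidable P) →
  length (filter P? (cartesianProduct (allFin n) (allFin n))) ≡ ∑∑ (λ i j → ⟦ does (P? (i , j)) ⟧)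
count-pairs {n} P? = trans (length-filter-product P? id (allFin n))
  (∑-cong λ i → length-filter-tabulate (P? ∘ (i ,_)) id)

count-triples : {P : U.Pred (Triple n) ℓ} (P? : U.Decidable P) →
  length (filter P? (cartesianProduct (allFin n) (cartesianProduct (allFin n) (allFin n)))) ≡
  ∑ (λ i → ∑∑ (λ j k → ⟦ does (P? (i , j , k)) ⟧))
count-triples {n} P? = trans (length-filter-product P? id (cartesianProduct (allFin n) (allFin n)))
  (∑-cong λ i → count-pairs (P? ∘ (i ,_)))

-- Boolean case checks and elementary inequalities

-- The goal fixes `P`, so the decision procedure can be given with holes; the implicit proof of
-- `True P?` is then found by evaluation.
decide : {P : Set ℓ} (P? : Dec P) {_ : True P?} → P
decide P? {p} = toWitness p

-- Linear arithmetic without subtraction: hypotheses summed up to a ≤ b leave, as a rule, a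
-- semiring identity.
combine : ∀ {a b x y} → a ≤ b → x + b ≤ y + a → x ≤ y
combine {a} {b} {x} {y} a≤b p = +-cancelʳ-≤ b x y (≤-trans p (+-monoʳ-≤ y a≤b))

-- The difference of the two sides is (x - y)²; ordering `x` and `y` first makes it the square of a
-- natural number `k`.
4xy≤[x+y]² : ∀ x y → 4 * (x * y) ≤ (x + y) * (x + y)
4xy≤[x+y]² x y with ≤-total x y
... | inj₁ x≤y with k , refl ← m≤n⇒∃[o]m+o≡n x≤y = ≤-trans (m≤m+n _ (k * k)) (≤-reflexive (lem x k))
  where lem : ∀ x k → 4 * (x * (x + k)) + k * k ≡ (x + (x + k)) * (x + (x + k))
        lem = solve-∀
... | inj₂ y≤x with k , refl ← m≤n⇒∃[o]m+o≡n y≤x = ≤-trans (m≤m+n _ (k * k)) (≤-reflexive (lem y k))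
  where lem : ∀ y k → 4 * ((y + k) * y) + k * k ≡ ((y + k) + y) * ((y + k) + y)
        lem = solve-∀

-- Counting triangles of a graph

⟦⟧-≤ : (a? : Dec A) {y : ℕ} → (A → 1 ≤ y) → ⟦ does a? ⟧ ≤ y
⟦⟧-≤ (yes a) f = f a
⟦⟧-≤ (no _)  f = z≤n

⟦⟧*-≤ : (a? : Dec A) {x y : ℕ} → (A → x ≤ y) → ⟦ does a? ⟧ * x ≤ y
⟦⟧*-≤ (yes a) {x} f = ≤-trans (≤-reflexive (*-identityˡ x)) (f a)
⟦⟧*-≤ (no _)  f = z≤n

module Counting {n : ℕ} (G : Graph n) where
  open Graph G

  e : Fin n → Fin n → Bool
  e i j = does (i ~? j)

  e-sym : ∀ i j → e i j ≡ e j i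
  e-sym i j with i ~? j
  ... | yes p = sym (dec-true (j ~? i) (~-sym p))
  ... | no ¬p = sym (dec-false (j ~? i) (¬p ∘ ~-sym))

  e-irrefl : ∀ i → e i i ≡ false
  e-irrefl i = dec-false (i ~? i) (~-irrefl refl)

  -- A listed edge has i < j, so it accounts for the two distinct entries (i, j) and (j, i) of the
  -- adjacency matrix.
  edges-≤ : edgeCount G + edgeCount G ≤ ∑∑ (λ i j → ⟦ e i j ⟧)
  edges-≤ = begin
    edgeCount G + edgeCount G
      ≡⟨ cong₂ _+_ (count-pairs (isEdge? G)) (trans (count-pairs (isEdge? G)) (sym (∑∑-comm ε))) ⟩
    ∑∑ ε + ∑∑ (λ i j → ε j i)       ≡⟨ ∑∑-+ ε (λ i j → ε j i) ⟨
    ∑∑ (λ i j → ε i j + ε j i)      ≤⟨ ∑∑-mono (λ i j → pointwise i j (Fin.<-cmp i j)) ⟩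
    ∑∑ (λ i j → ⟦ e i j ⟧)          ∎
    where
    open ≤-Reasoning
    ε : Fin n → Fin n → ℕ
    ε i j = ⟦ does (isEdge? G (i , j)) ⟧

    ε-≤ : ∀ i j → ε i j ≤ ⟦ e i j ⟧
    ε-≤ i j = ⟦⟧-≤ (isEdge? G (i , j)) λ (_ , i~j) → ≤-reflexive (cong ⟦_⟧ (sym (dec-true (i ~? j) i~j)))

    ε-zero : ∀ i j → ¬ (i Fin.< j) → ε i j ≡ 0
    ε-zero i j i≮j = cong ⟦_⟧ (dec-false (isEdge? G (i , j)) (i≮j ∘ proj₁))

    pointwise : ∀ i j → Tri (i Fin.< j) (i ≡ j) (j Fin.< i) → ε i j + ε j i ≤ ⟦ e i j ⟧
    pointwise i j (tri< _ _ j≮i) rewrite ε-zero j i j≮i | +-identityʳ (ε i j) = ε-≤ i j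
    pointwise i j (tri≈ i≮j _ j≮i) rewrite ε-zero i j i≮j | ε-zero j i j≮i = z≤n
    pointwise i j (tri> i≮j _ _) rewrite ε-zero i j i≮j | e-sym i j = ε-≤ j i

  τ : Fin n → Fin n → Fin n → ℕ
  τ i j k = ⟦ does (isTriangle? G (i , j , k)) ⟧

  τ≥1 : ∀ {i j k} → i Fin.< j → j Fin.< k → i ~ j → i ~ k → j ~ k → 1 ≤ τ i j k
  τ≥1 {i} {j} {k} i<j j<k ij ik jk = ≤-reflexive (cong ⟦_⟧ (sym (dec-true (isTriangle? G (i , j , k))
    ((i<j , ij) , (Fin.<-trans i<j j<k , ik) , (j<k , jk)))))

  ∑∑∑τ : ∑ (λ i → ∑∑ (τ i)) ≡ t G
  ∑∑∑τ = sym (count-triples (isTriangle? G))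

  ordered : Fin n → Fin n → Fin n → ℕ
  ordered i j k = ⟦ e i j ⟧ * (⟦ e i k ⟧ * ⟦ e j k ⟧)

  here : ∀ {x y} → 1 ≤ x → 1 ≤ x + y
  here p = m≤n⇒m≤n+o _ p

  there : ∀ x {y} → 1 ≤ y → 1 ≤ x + y
  there x p = m≤n⇒m≤o+n x p

  -- Sorting the vertices of a triangle selects the one of its six orders that is listed. Each
  -- clause after the equalities uses only two comparisons, which also disposes of the two
  -- impossible cyclic patterns.
  ordered-≤ : ∀ i j k → ordered i j k ≤
    τ i j k + (τ i k j + (τ j i k + (τ j k i + (τ k i j + τ k j i))))
  ordered-≤ i j k = ⟦⟧*-≤ (i ~? j) λ ij → ⟦⟧*-≤ (i ~? k) λ ik → ⟦⟧-≤ (j ~? k) λ jk →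
    cases ij ik jk (Fin.<-cmp i j) (Fin.<-cmp i k) (Fin.<-cmp j k)
    where
    cases : i ~ j → i ~ k → j ~ k → Tri (i Fin.< j) (i ≡ j) (j Fin.< i) →
      Tri (i Fin.< k) (i ≡ k) (k Fin.< i) → Tri (j Fin.< k) (j ≡ k) (k Fin.< j) →
      1 ≤ τ i j k + (τ i k j + (τ j i k + (τ j k i + (τ k i j + τ k j i))))
    cases ij ik jk (tri≈ _ i≡j _) _ _ = contradiction ij (~-irrefl i≡j)
    cases ij ik jk _ (tri≈ _ i≡k _) _ = contradiction ik (~-irrefl i≡k)
    cases ij ik jk _ _ (tri≈ _ j≡k _) = contradiction jk (~-irrefl j≡k)
    cases ij ik jk (tri< i<j _ _) _ (tri< j<k _ _) = here (τ≥1 i<j j<k ij ik jk)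
    cases ij ik jk _ (tri< i<k _ _) (tri> _ _ k<j) =
      there (τ i j k) (here (τ≥1 i<k k<j ik ij (~-sym jk)))
    cases ij ik jk (tri> _ _ j<i) (tri< i<k _ _) _ =
      there (τ i j k) (there (τ i k j) (here (τ≥1 j<i i<k (~-sym ij) jk ik)))
    cases ij ik jk _ (tri> _ _ k<i) (tri< j<k _ _) =
      there (τ i j k) (there (τ i k j) (there (τ j i k) (here (τ≥1 j<k k<i jk (~-sym ij) (~-sym ik)))))
    cases ij ik jk (tri< i<j _ _) (tri> _ _ k<i) _ =
      there (τ i j k) (there (τ i k j) (there (τ j i k) (there (τ j k i)
        (here (τ≥1 k<i i<j (~-sym ik) (~-sym jk) ij)))))
    cases ij ik jk (tri> _ _ j<i) _ (tri> _ _ k<j) =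
      there (τ i j k) (there (τ i k j) (there (τ j i k) (there (τ j k i) (there (τ k i j)
        (τ≥1 k<j j<i (~-sym jk) (~-sym ik) (~-sym ij))))))

  ∑∑∑ordered-≤ : ∑ (λ i → ∑∑ (ordered i)) ≤ 6 * t G
  ∑∑∑ordered-≤ = begin
    Σ₃ ordered
      ≤⟨ ∑-mono (λ i → ∑∑-mono (ordered-≤ i)) ⟩
    Σ₃ (λ i j k → τ i j k + (τ i k j + (τ j i k + (τ j k i + (τ k i j + τ k j i)))))
      ≡⟨ Σ₃-+ τ _ ⟩
    Σ₃ τ + _
      ≡⟨ cong (Σ₃ τ +_) (Σ₃-+ (λ i j k → τ i k j) _) ⟩
    Σ₃ τ + (Σ₃ (λ i j k → τ i k j) + _)
      ≡⟨ cong (λ x → Σ₃ τ + (Σ₃ (λ i j k → τ i k j) + x)) (Σ₃-+ (λ i j k → τ j i k) _) ⟩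
    Σ₃ τ + (Σ₃ (λ i j k → τ i k j) + (Σ₃ (λ i j k → τ j i k) + _))
      ≡⟨ cong (λ x → Σ₃ τ + (Σ₃ (λ i j k → τ i k j) + (Σ₃ (λ i j k → τ j i k) + x)))
           (trans (Σ₃-+ (λ i j k → τ j k i) _)
             (cong (Σ₃ (λ i j k → τ j k i) +_) (Σ₃-+ (λ i j k → τ k i j) (λ i j k → τ k j i)))) ⟩
    Σ₃ τ + (Σ₃ (λ i j k → τ i k j) + (Σ₃ (λ i j k → τ j i k)
      + (Σ₃ (λ i j k → τ j k i) + (Σ₃ (λ i j k → τ k i j) + Σ₃ (λ i j k → τ k j i)))))
      ≡⟨ cong₂ _+_ ∑∑∑τ (cong₂ _+_ (trans (swap₂₃ τ) ∑∑∑τ) (cong₂ _+_ (trans (swap₁₂ τ) ∑∑∑τ)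
           (cong₂ _+_ (trans (swap₁₂ (λ i j k → τ i k j)) (trans (swap₂₃ τ) ∑∑∑τ))
           (cong₂ _+_ (trans (swap₂₃ (λ i j k → τ j i k)) (trans (swap₁₂ τ) ∑∑∑τ))
             (trans (swap₁₂ (λ i j k → τ k i j)) (trans (swap₂₃ (λ i j k → τ j i k)) (trans (swap₁₂ τ) ∑∑∑τ))))))) ⟩
    t G + (t G + (t G + (t G + (t G + t G))))
      ≡⟨ six (t G) ⟩
    6 * t G ∎
    where
    open ≤-Reasoning
    Σ₃ : (Fin n → Fin n → Fin n → ℕ) → ℕ
    Σ₃ f = ∑ (λ i → ∑∑ (f i))

    Σ₃-+ : ∀ f g → Σ₃ (λ i j k → f i j k + g i j k) ≡ Σ₃ f + Σ₃ g
    Σ₃-+ f g = trans (∑-cong λ i → ∑∑-+ (f i) (g i)) (∑-+ (λ i → ∑∑ (f i)) (λ i → ∑∑ (g i)))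

    swap₂₃ : ∀ f → Σ₃ (λ i j k → f i k j) ≡ Σ₃ f
    swap₂₃ f = ∑-cong λ i → ∑∑-comm (f i)

    swap₁₂ : ∀ f → Σ₃ (λ i j k → f j i k) ≡ Σ₃ f
    swap₁₂ f = ∑∑-comm (λ i j → ∑ (f i j))

    six : ∀ x → x + (x + (x + (x + (x + x)))) ≡ 6 * x
    six = solve-∀

  -- Without loops `ordered` vanishes as soon as two of the vertices coincide; otherwise `v` equals
  -- at most one of the three.
  δ-≤ : ∀ v i j k → ⟦ δ v i ⟧ * ordered i j k + (⟦ δ v j ⟧ * ordered i j k + ⟦ δ v k ⟧ * ordered i j k)
        ≤ ordered i j k
  δ-≤ v i j k = cases (v Fin.≟ i) (v Fin.≟ j) (v Fin.≟ k)
    where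
    vanish : ∀ a b c {p} → p ≡ 0 → a * p + (b * p + c * p) ≤ p
    vanish a b c refl rewrite *-zeroʳ a | *-zeroʳ b | *-zeroʳ c = z≤n

    i≡j⇒0 : i ≡ j → ordered i j k ≡ 0
    i≡j⇒0 refl rewrite e-irrefl i = refl

    i≡k⇒0 : i ≡ k → ordered i j k ≡ 0
    i≡k⇒0 refl rewrite e-irrefl i = *-zeroʳ ⟦ e i j ⟧

    j≡k⇒0 : j ≡ k → ordered i j k ≡ 0
    j≡k⇒0 refl rewrite e-irrefl j | *-zeroʳ ⟦ e i j ⟧ = *-zeroʳ ⟦ e i j ⟧

    cases : (p : Dec (v ≡ i)) (q : Dec (v ≡ j)) (r : Dec (v ≡ k)) →
      ⟦ does p ⟧ * ordered i j k + (⟦ does q ⟧ * ordered i j k + ⟦ does r ⟧ * ordered i j k) ≤ ordered i j k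
    cases (yes p) (yes q) r       = vanish 1 1 ⟦ does r ⟧ (i≡j⇒0 (trans (sym p) q))
    cases (yes p) q       (yes r) = vanish 1 ⟦ does q ⟧ 1 (i≡k⇒0 (trans (sym p) r))
    cases p       (yes q) (yes r) = vanish ⟦ does p ⟧ 1 1 (j≡k⇒0 (trans (sym q) r))
    cases (yes _) (no _)  (no _)  = ≤-reflexive (lem (ordered i j k))
      where lem : ∀ x → 1 * x + (0 * x + 0 * x) ≡ x
            lem = solve-∀
    cases (no _)  (yes _) (no _)  = ≤-reflexive (lem (ordered i j k))
      where lem : ∀ x → 0 * x + (1 * x + 0 * x) ≡ x
            lem = solve-∀
    cases (no _)  (no _)  (yes _) = ≤-reflexive (lem (ordered i j k))
      where lem : ∀ x → 0 * x + (0 * x + 1 * x) ≡ x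
            lem = solve-∀
    cases (no _)  (no _)  (no _)  = z≤n

  -- By symmetry `v` is the first, the second and the third vertex of equally many ordered
  -- triangles. Three times this sum is therefore part of the count of all of them, which is at most
  -- 6 t.
  ∑∑ordered-≤ : ∀ v → ∑∑ (ordered v) ≤ 2 * t G
  ∑∑ordered-≤ v = *-cancelˡ-≤ 3 (begin
    3 * ∑∑ (ordered v)
      ≡⟨ three (∑∑ (ordered v)) ⟩
    ∑∑ (ordered v) + (∑∑ (ordered v) + ∑∑ (ordered v))
      ≡⟨ cong₂ _+_ (sym at-i) (cong₂ _+_ (sym at-j) (sym at-k)) ⟩
    ∑ (λ i → ∑∑ (f i)) + (∑ (λ i → ∑∑ (g i)) + ∑ (λ i → ∑∑ (h i)))
      ≡⟨ cong (∑ (λ i → ∑∑ (f i)) +_) (∑-+ (λ i → ∑∑ (g i)) (λ i → ∑∑ (h i))) ⟨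
    ∑ (λ i → ∑∑ (f i)) + ∑ (λ i → ∑∑ (g i) + ∑∑ (h i))
      ≡⟨ ∑-+ (λ i → ∑∑ (f i)) (λ i → ∑∑ (g i) + ∑∑ (h i)) ⟨
    ∑ (λ i → ∑∑ (f i) + (∑∑ (g i) + ∑∑ (h i)))
      ≡⟨ ∑-cong (λ i → trans (∑∑-+ (f i) (λ j k → g i j k + h i j k)) (cong (∑∑ (f i) +_) (∑∑-+ (g i) (h i)))) ⟨
    ∑ (λ i → ∑∑ (λ j k → f i j k + (g i j k + h i j k)))
      ≤⟨ ∑-mono (λ i → ∑∑-mono (δ-≤ v i)) ⟩
    ∑ (λ i → ∑∑ (ordered i))
      ≤⟨ ∑∑∑ordered-≤ ⟩
    6 * t G
      ≡⟨ *-assoc 3 2 (t G) ⟩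
    3 * (2 * t G) ∎)
    where
    open ≤-Reasoning
    f g h : Fin n → Fin n → Fin n → ℕ
    f i j k = ⟦ δ v i ⟧ * ordered i j k
    g i j k = ⟦ δ v j ⟧ * ordered i j k
    h i j k = ⟦ δ v k ⟧ * ordered i j k

    three : ∀ x → 3 * x ≡ x + (x + x)
    three = solve-∀

    rotate : ∀ x y z → x * (y * z) ≡ y * (z * x)
    rotate = solve-∀

    transpose : ∀ x y z → x * (y * z) ≡ x * (z * y)
    transpose = solve-∀

    at-i : ∑ (λ i → ∑∑ (f i)) ≡ ∑∑ (ordered v)
    at-i = trans (∑-cong λ i → ∑∑-*ˡ ⟦ δ v i ⟧ (ordered i)) (∑-δ v (λ i → ∑∑ (ordered i)))

    at-j : ∑ (λ i → ∑∑ (g i)) ≡ ∑∑ (ordered v)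
    at-j = trans (∑-cong λ i → ∑∑-δˡ v (ordered i)) (∑∑-cong λ i k →
      trans (cong (λ x → ⟦ x ⟧ * (⟦ e i k ⟧ * ⟦ e v k ⟧)) (e-sym i v)) (transpose ⟦ e v i ⟧ ⟦ e i k ⟧ ⟦ e v k ⟧))

    at-k : ∑ (λ i → ∑∑ (h i)) ≡ ∑∑ (ordered v)
    at-k = trans (∑-cong λ i → ∑∑-δʳ v (ordered i)) (∑∑-cong λ i j →
      trans (cong₂ (λ x y → ⟦ e i j ⟧ * (⟦ x ⟧ * ⟦ y ⟧)) (e-sym i v) (e-sym j v)) (rotate ⟦ e i j ⟧ ⟦ e v i ⟧ ⟦ e v j ⟧))

  codegree : Fin n → Fin n → ℕ
  codegree u v = ∑ (λ k → ⟦ e u k ⟧ * ⟦ e v k ⟧)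

  -- A common neighbour `k` gives a triangle whose sorted form has `k` last, in the middle or first;
  -- the three sums `f`, `g`, `h` follow the resulting positions of `u` and `v`.
  codegree≤bookSize : ∀ {u v} → u Fin.< v → u ~ v → codegree u v ≤ bookSize G (u , v)
  codegree≤bookSize {u} {v} u<v uv = begin
    codegree u v
      ≤⟨ ∑-mono (λ k → ⟦⟧*-≤ (u ~? k) λ uk → ⟦⟧-≤ (v ~? k) λ vk →
           sorted uk vk (Fin.<-cmp u k) (Fin.<-cmp v k)) ⟩
    ∑ (λ k → τ u v k + (τ u k v + τ k u v))
      ≡⟨ trans (∑-+ (τ u v) (λ k → τ u k v + τ k u v)) (cong (∑ (τ u v) +_) (∑-+ (λ k → τ u k v) (λ k → τ k u v))) ⟩
    ∑ (τ u v) + (∑ (λ k → τ u k v) + ∑ (λ k → τ k u v))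
      ≡⟨ cong₂ _+_ (sym at-ij) (cong₂ _+_ (sym at-ik) (sym at-jk)) ⟩
    ∑ (λ i → ∑∑ (f i)) + (∑ (λ i → ∑∑ (g i)) + ∑ (λ i → ∑∑ (h i)))
      ≡⟨ cong (∑ (λ i → ∑∑ (f i)) +_) (∑-+ (λ i → ∑∑ (g i)) (λ i → ∑∑ (h i))) ⟨
    ∑ (λ i → ∑∑ (f i)) + ∑ (λ i → ∑∑ (g i) + ∑∑ (h i))
      ≡⟨ ∑-+ (λ i → ∑∑ (f i)) (λ i → ∑∑ (g i) + ∑∑ (h i)) ⟨
    ∑ (λ i → ∑∑ (f i) + (∑∑ (g i) + ∑∑ (h i)))
      ≡⟨ ∑-cong (λ i → trans (∑∑-+ (f i) (λ j k → g i j k + h i j k)) (cong (∑∑ (f i) +_) (∑∑-+ (g i) (h i)))) ⟨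
    ∑ (λ i → ∑∑ (λ j k → f i j k + (g i j k + h i j k)))
      ≤⟨ ∑-mono (λ i → ∑∑-mono (contained i)) ⟩
    ∑ (λ i → ∑∑ (λ j k → ⟦ does (isTriangle? G (i , j , k) ×-dec contains? (u , v) (i , j , k)) ⟧))
      ≡⟨ count-triples (λ x → isTriangle? G x ×-dec contains? (u , v) x) ⟨
    _ ≡⟨ length-filter-filter (isTriangle? G) (contains? (u , v)) triples ⟨
    bookSize G (u , v) ∎
    where
    open ≤-Reasoning
    triples = cartesianProduct (allFin n) (cartesianProduct (allFin n) (allFin n))

    f g h : Fin n → Fin n → Fin n → ℕ
    f i j k = ⟦ δ u i ⟧ * (⟦ δ v j ⟧ * τ i j k)
    g i j k = ⟦ δ u i ⟧ * (⟦ δ v k ⟧ * τ i j k)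
    h i j k = ⟦ δ u j ⟧ * (⟦ δ v k ⟧ * τ i j k)

    at-ij : ∑ (λ i → ∑∑ (f i)) ≡ ∑ (τ u v)
    at-ij = trans (∑-cong λ i → ∑∑-*ˡ ⟦ δ u i ⟧ (λ j k → ⟦ δ v j ⟧ * τ i j k))
      (trans (∑-δ u (λ i → ∑∑ (λ j k → ⟦ δ v j ⟧ * τ i j k))) (∑∑-δˡ v (τ u)))

    at-ik : ∑ (λ i → ∑∑ (g i)) ≡ ∑ (λ k → τ u k v)
    at-ik = trans (∑-cong λ i → ∑∑-*ˡ ⟦ δ u i ⟧ (λ j k → ⟦ δ v k ⟧ * τ i j k))
      (trans (∑-δ u (λ i → ∑∑ (λ j k → ⟦ δ v k ⟧ * τ i j k))) (∑∑-δʳ v (τ u)))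

    at-jk : ∑ (λ i → ∑∑ (h i)) ≡ ∑ (λ k → τ k u v)
    at-jk = ∑-cong λ i → trans (∑∑-δˡ u (λ j k → ⟦ δ v k ⟧ * τ i j k)) (∑-δ v (τ i u))

    sorted : ∀ {k} → u ~ k → v ~ k → Tri (u Fin.< k) (u ≡ k) (k Fin.< u) →
      Tri (v Fin.< k) (v ≡ k) (k Fin.< v) → 1 ≤ τ u v k + (τ u k v + τ k u v)
    sorted uk vk (tri≈ _ u≡k _) _ = contradiction uk (~-irrefl u≡k)
    sorted uk vk _ (tri≈ _ v≡k _) = contradiction vk (~-irrefl v≡k)
    sorted uk vk _ (tri< v<k _ _) = here (τ≥1 u<v v<k uv uk vk)
    sorted {k} uk vk (tri< u<k _ _) (tri> _ _ k<v) =
      there (τ u v k) (here (τ≥1 u<k k<v uk uv (~-sym vk)))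
    sorted {k} uk vk (tri> _ _ k<u) (tri> _ _ k<v) =
      there (τ u v k) (there (τ u k v) (τ≥1 k<u u<v (~-sym uk) (~-sym vk) uv))

    -- In a strictly increasing triple at most one of the three position patterns can hold.
    contained : ∀ i j k → f i j k + (g i j k + h i j k) ≤
      ⟦ does (isTriangle? G (i , j , k) ×-dec contains? (u , v) (i , j , k)) ⟧
    contained i j k = cases (isTriangle? G (i , j , k)) (u Fin.≟ i) (u Fin.≟ j) (v Fin.≟ j) (v Fin.≟ k)
      where
      hit : 1 ≤ ⟦ δ v i ∨ true ⟧
      hit = ≤-reflexive (cong ⟦_⟧ (sym (Bool.∨-zeroʳ (δ v i))))

      cases : (p : Dec (IsTriangle G (i , j , k))) (ui : Dec (u ≡ i)) (uj : Dec (u ≡ j)) (vj : Dec (v ≡ j)) (vk : Dec (v ≡ k)) →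
        ⟦ does ui ⟧ * (⟦ does vj ⟧ * ⟦ does p ⟧) + (⟦ does ui ⟧ * (⟦ does vk ⟧ * ⟦ does p ⟧) + ⟦ does uj ⟧ * (⟦ does vk ⟧ * ⟦ does p ⟧))
        ≤ ⟦ does p ∧ ((does ui ∨ (does uj ∨ δ u k)) ∧ (δ v i ∨ (does vj ∨ does vk))) ⟧
      cases (no _) ui uj vj vk
        rewrite *-zeroʳ ⟦ does vj ⟧ | *-zeroʳ ⟦ does vk ⟧ | *-zeroʳ ⟦ does ui ⟧ | *-zeroʳ ⟦ does uj ⟧ = z≤n
      cases (yes ((i<j , _) , _)) (yes refl) (yes refl) _ _ = contradiction i<j (Fin.<-irrefl refl)
      cases (yes (_ , _ , (j<k , _))) _ _ (yes refl) (yes refl) = contradiction j<k (Fin.<-irrefl refl)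
      cases (yes _) (yes _) (no _)  (yes _) (no _)  = hit
      cases (yes _) (yes _) (no _)  (no _)  (yes _) = hit
      cases (yes _) (yes _) (no _)  (no _)  (no _)  = z≤n
      cases (yes _) (no _)  (yes _) (no _)  (yes _) = hit
      cases (yes _) (no _)  (yes _) (yes _) (no _)  = z≤n
      cases (yes _) (no _)  (yes _) (no _)  (no _)  = z≤n
      cases (yes _) (no _)  (no _)  (yes _) (no _)  = z≤n
      cases (yes _) (no _)  (no _)  (no _)  (yes _) = z≤n
      cases (yes _) (no _)  (no _)  (no _)  (no _)  = z≤n

  bookSize≤b : ∀ {u v} → u Fin.< v → u ~ v → bookSize G (u , v) ≤ b G
  bookSize≤b {u} {v} u<v uv = All.lookup (xs≤max 0 _) (∈-map⁺ (bookSize G)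
    (∈-filter⁺ (isEdge? G) (∈-cartesianProduct⁺ (∈-allFin u) (∈-allFin v)) (u<v , uv)))

  codegree≤b : ∀ {u v} → u ~ v → codegree u v ≤ b G
  codegree≤b {u} {v} uv with Fin.<-cmp u v
  ... | tri< u<v _ _ = ≤-trans (codegree≤bookSize u<v uv) (bookSize≤b u<v uv)
  ... | tri≈ _ u≡v _ = contradiction uv (~-irrefl u≡v)
  ... | tri> _ _ v<u = ≤-trans (≤-reflexive (∑-cong λ k → *-comm ⟦ e u k ⟧ ⟦ e v k ⟧))
                         (≤-trans (codegree≤bookSize v<u (~-sym uv)) (bookSize≤b v<u (~-sym uv)))

-- Cuts

module Cuts {n : ℕ} (e : Fin n → Fin n → Bool)
            (e-sym : ∀ i j → e i j ≡ e j i) (e-irrefl : ∀ i → e i i ≡ false) where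

  infix 8 _∥_
  _∥_ : Bool → Bool → Bool
  x ∥ y = not (x xor y)

  degree : Fin n → ℕ
  degree i = ∑ (λ j → ⟦ e i j ⟧)

  -- A cut is a two-colouring `c` of the vertices. Sums over `v` count every pair in both orders:
  -- `∑ (inner c)` is twice the number of inner edges.
  inner outer missing opposite : (Fin n → Bool) → Fin n → ℕ
  inner    c v = ∑ (λ j → ⟦ e v j ∧ c v ∥ c j ⟧)
  outer    c v = ∑ (λ j → ⟦ e v j ∧ (c v xor c j) ⟧)
  missing  c v = ∑ (λ j → ⟦ not (e v j) ∧ (c v xor c j) ⟧)
  opposite c v = ∑ (λ j → ⟦ c v xor c j ⟧)

  -- Counts ordered pairs of adjacent neighbours, hence every triangle at `v` twice.
  triangles-at : Fin n → ℕ
  triangles-at v = ∑∑ (λ j k → ⟦ e v j ⟧ * (⟦ e v k ⟧ * ⟦ e j k ⟧))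

  -- For an ordered edge (i, j), the indicator of being inner plus the number of ends in N(u) is one
  -- more than twice the indicator that both ends are in N(u).
  neighbourhood-cut : ∀ u →
    ∑ (inner (e u)) + 2 * ∑ (λ i → ⟦ e u i ⟧ * degree i) ≡ 2 * triangles-at u + ∑ degree
  neighbourhood-cut u = begin
    ∑ (inner (e u)) + 2 * ∑ (λ i → ⟦ e u i ⟧ * degree i)
      ≡⟨ cong (∑ (inner (e u)) +_) (trans (two (∑ (λ i → ⟦ e u i ⟧ * degree i))) (sym (cong₂ _+_ row column))) ⟩
    ∑ (inner (e u)) + (∑∑ f + ∑∑ g)
      ≡⟨ cong (∑ (inner (e u)) +_) (∑∑-+ f g) ⟨
    ∑ (inner (e u)) + ∑∑ (λ i j → f i j + g i j)
      ≡⟨ ∑∑-+ (λ i j → ⟦ e i j ∧ e u i ∥ e u j ⟧) (λ i j → f i j + g i j) ⟨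
    ∑∑ (λ i j → ⟦ e i j ∧ e u i ∥ e u j ⟧ + (f i j + g i j))
      ≡⟨ ∑∑-cong (λ i j → pointwise (e u i) (e u j) (e i j)) ⟩
    ∑∑ (λ i j → 2 * h i j + ⟦ e i j ⟧)
      ≡⟨ ∑∑-+ (λ i j → 2 * h i j) (λ i j → ⟦ e i j ⟧) ⟩
    ∑∑ (λ i j → 2 * h i j) + ∑ degree
      ≡⟨ cong (_+ ∑ degree) (∑∑-*ˡ 2 h) ⟩
    2 * triangles-at u + ∑ degree ∎
    where
    open ≡-Reasoning
    f g h : Fin n → Fin n → ℕ
    f i j = ⟦ e u i ⟧ * ⟦ e i j ⟧
    g i j = ⟦ e u j ⟧ * ⟦ e i j ⟧
    h i j = ⟦ e u i ⟧ * (⟦ e u j ⟧ * ⟦ e i j ⟧)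

    two : ∀ x → 2 * x ≡ x + x
    two = solve-∀

    row : ∑∑ f ≡ ∑ (λ i → ⟦ e u i ⟧ * degree i)
    row = ∑-cong λ i → ∑-*ˡ ⟦ e u i ⟧ (λ j → ⟦ e i j ⟧)

    column : ∑∑ g ≡ ∑ (λ i → ⟦ e u i ⟧ * degree i)
    column = trans (∑∑-cong λ i j → cong (λ x → ⟦ e u j ⟧ * ⟦ x ⟧) (e-sym i j)) (trans (∑∑-comm f) row)

    pointwise : ∀ x y z → ⟦ z ∧ x ∥ y ⟧ + (⟦ x ⟧ * ⟦ z ⟧ + ⟦ y ⟧ * ⟦ z ⟧) ≡ 2 * (⟦ x ⟧ * (⟦ y ⟧ * ⟦ z ⟧)) + ⟦ z ⟧
    pointwise = decide (∀-Bool? λ x → ∀-Bool? λ y → ∀-Bool? λ z → _ ≟ _)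

  -- Double counting: the degree of `i` is added once for each neighbour `u` of `i`.
  ∑-squares : ∑ (λ u → ∑ (λ i → ⟦ e u i ⟧ * degree i)) ≡ ∑ (λ i → degree i * degree i)
  ∑-squares = trans (sym (∑∑-comm (λ u i → ⟦ e u i ⟧ * degree i)))
    (∑-cong λ i → trans (∑-*ʳ (degree i) (λ u → ⟦ e u i ⟧)) (cong (_* degree i) (∑-cong λ u → cong ⟦_⟧ (e-sym u i))))

  -- Averaging over the cuts (N(u), V \ N(u)); the sum of squared degrees enters with a negative sign.
  sparse-cut : ∀ t → 0 < n → n * n ≤ 2 * ∑ degree → ∑ triangles-at ≤ 6 * t → 16 * t ≤ n * n →
    ∃[ u ] 4 * ∑ (inner (e u)) ≤ 3 * n
  sparse-cut t 0<n n²≤2D T≤6t 16t≤n² =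
    ∑-≤⇒∃ (λ u → 4 * ∑ (inner (e u))) (3 * n) 0<n (begin
      ∑ (λ u → 4 * ∑ (inner (e u)))  ≡⟨ ∑-*ˡ 4 (λ u → ∑ (inner (e u))) ⟩
      4 * K                          ≤⟨ bound K (∑ triangles-at) W D n t summed squares n²≤2D T≤6t 16t≤n² ⟩
      n * (3 * n)                    ∎)
    where
    open ≤-Reasoning
    K = ∑ (λ u → ∑ (inner (e u)))
    W = ∑ (λ i → degree i * degree i)
    D = ∑ degree

    summed : K + 2 * W ≡ 2 * ∑ triangles-at + n * D
    summed = trans (cong (λ x → K + 2 * x) (sym ∑-squares))
      (trans (cong (K +_) (sym (∑-*ˡ 2 (λ u → ∑ (λ i → ⟦ e u i ⟧ * degree i)))))
      (trans (sym (∑-+ (λ u → ∑ (inner (e u))) (λ u → 2 * ∑ (λ i → ⟦ e u i ⟧ * degree i))))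
      (trans (∑-cong neighbourhood-cut)
      (trans (∑-+ (λ u → 2 * triangles-at u) (λ _ → D))
             (cong₂ _+_ (∑-*ˡ 2 triangles-at) (∑-const n D))))))

    -- Sums (2 d - n)² ≥ 0 over all degrees d: the tangent to d² at n / 2, the average degree that
    -- n² / 4 edges give.
    squares : 4 * (n * D) ≤ 4 * W + n * (n * n)
    squares = begin
      4 * (n * D)                                  ≡⟨ *-assoc 4 n D ⟨
      4 * n * D                                    ≡⟨ ∑-*ˡ (4 * n) degree ⟨
      ∑ (λ i → 4 * n * degree i)                   ≤⟨ ∑-mono (λ i → am-gm (degree i)) ⟩
      ∑ (λ i → 4 * (degree i * degree i) + n * n)  ≡⟨ ∑-+ (λ i → 4 * (degree i * degree i)) (λ _ → n * n) ⟩
      ∑ (λ i → 4 * (degree i * degree i)) + ∑ {n} (λ _ → n * n)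
        ≡⟨ cong₂ _+_ (∑-*ˡ 4 (λ i → degree i * degree i)) (∑-const n (n * n)) ⟩
      4 * W + n * (n * n)                          ∎
      where
      am-gm : ∀ d → 4 * n * d ≤ 4 * (d * d) + n * n
      am-gm d = combine (4xy≤[x+y]² (2 * d) n) (≤-reflexive (lem n d))
        where lem : ∀ n d → 4 * n * d + (2 * d + n) * (2 * d + n) ≡ 4 * (d * d) + n * n + 4 * (2 * d * n)
              lem = solve-∀

    -- 4 K = 8 T + 4 n D - 8 W ≤ 8 T - 4 n D + 2 n³ ≤ 8 T ≤ 48 t ≤ 3 n².
    bound : ∀ K T W D n t → K + 2 * W ≡ 2 * T + n * D → 4 * (n * D) ≤ 4 * W + n * (n * n) →
      n * n ≤ 2 * D → T ≤ 6 * t → 16 * t ≤ n * n → 4 * K ≤ n * (3 * n)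
    bound K T W D n t p q r s w = combine
      (+-mono-≤ (+-mono-≤ (+-mono-≤ (*-monoʳ-≤ 4 (≤-reflexive p)) (*-monoʳ-≤ 2 q)) (*-monoʳ-≤ (2 * n) r))
                (+-mono-≤ (*-monoʳ-≤ 8 s) (*-monoʳ-≤ 3 w)))
      (≤-reflexive (lem K T W D n t))
      where
      lem : ∀ K T W D n t →
        4 * K + (4 * (2 * T + n * D) + 2 * (4 * W + n * (n * n)) + 2 * n * (2 * D) + (8 * (6 * t) + 3 * (n * n))) ≡
        n * (3 * n) + (4 * (K + 2 * W) + 2 * (4 * (n * D)) + 2 * n * (n * n) + (8 * T + 3 * (16 * t)))
      lem = solve-∀

  flip : (Fin n → Bool) → Fin n → Fin n → Bool
  flip c v i = δ v i xor c i

  -- Moving `v` across exchanges its inner and outer edges and keeps the kind of all others; each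
  -- edge at `v` occurs twice in the sums.
  flip-inner : ∀ c v → ∑ (inner (flip c v)) + 2 * inner c v ≡ ∑ (inner c) + 2 * outer c v
  flip-inner c v = begin
    ∑ (inner (flip c v)) + 2 * inner c v
      ≡⟨ cong (∑ (inner (flip c v)) +_) (expand f (inner c v) (λ i j → cong₂ (λ x y → ⟦ x ∧ not y ⟧) (e-sym i j) (Bool.xor-comm (c i) (c j))) refl) ⟩
    ∑∑ (λ i j → ⟦ e i j ∧ flip c v i ∥ flip c v j ⟧) + ∑∑ (λ i j → ⟦ δ v i ⟧ * f i j + ⟦ δ v j ⟧ * f i j)
      ≡⟨ ∑∑-+ (λ i j → ⟦ e i j ∧ flip c v i ∥ flip c v j ⟧) _ ⟨
    ∑∑ (λ i j → ⟦ e i j ∧ flip c v i ∥ flip c v j ⟧ + (⟦ δ v i ⟧ * f i j + ⟦ δ v j ⟧ * f i j))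
      ≡⟨ ∑∑-cong (λ i j → pointwise (δ v i) (δ v j) (c i) (c j) (e i j) (loop i j)) ⟩
    ∑∑ (λ i j → f i j + (⟦ δ v i ⟧ * g i j + ⟦ δ v j ⟧ * g i j))
      ≡⟨ ∑∑-+ f _ ⟩
    ∑ (inner c) + ∑∑ (λ i j → ⟦ δ v i ⟧ * g i j + ⟦ δ v j ⟧ * g i j)
      ≡⟨ cong (∑ (inner c) +_) (expand g (outer c v) (λ i j → cong₂ (λ x y → ⟦ x ∧ y ⟧) (e-sym i j) (Bool.xor-comm (c i) (c j))) refl) ⟨
    ∑ (inner c) + 2 * outer c v ∎
    where
    open ≡-Reasoning
    f g : Fin n → Fin n → ℕ
    f i j = ⟦ e i j ∧ c i ∥ c j ⟧
    g i j = ⟦ e i j ∧ (c i xor c j) ⟧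

    expand : ∀ h x → (∀ i j → h i j ≡ h j i) → ∑ (h v) ≡ x →
      2 * x ≡ ∑∑ (λ i j → ⟦ δ v i ⟧ * h i j + ⟦ δ v j ⟧ * h i j)
    expand h x h-sym refl = trans (cong (∑ (h v) +_) (+-identityʳ _)) (sym (trans
      (∑∑-+ (λ i j → ⟦ δ v i ⟧ * h i j) (λ i j → ⟦ δ v j ⟧ * h i j))
      (cong₂ _+_ (∑∑-δˡ v h) (trans (∑∑-δʳ v h) (∑-cong λ i → h-sym i v)))))

    -- The pointwise identity would fail for an edge with i = j = v, so the absence of loops enters
    -- here.
    loop : ∀ i j → δ v i ∧ δ v j ∧ e i j ≡ false
    loop i j with v Fin.≟ i | v Fin.≟ j
    ... | no _     | _        = refl
    ... | yes _    | no _     = refl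
    ... | yes refl | yes refl = e-irrefl v

    pointwise : ∀ p q x y z → p ∧ q ∧ z ≡ false →
      ⟦ z ∧ (p xor x) ∥ (q xor y) ⟧ + (⟦ p ⟧ * ⟦ z ∧ x ∥ y ⟧ + ⟦ q ⟧ * ⟦ z ∧ x ∥ y ⟧) ≡
      ⟦ z ∧ x ∥ y ⟧ + (⟦ p ⟧ * ⟦ z ∧ (x xor y) ⟧ + ⟦ q ⟧ * ⟦ z ∧ (x xor y) ⟧)
    pointwise = decide (∀-Bool? λ p → ∀-Bool? λ q → ∀-Bool? λ x → ∀-Bool? λ y → ∀-Bool? λ z →
      (_ Bool.≟ _) →-dec (_ ≟ _))

  -- Moving a vertex with more inner than outer neighbours lowers `∑ (inner c)`, so such moves come
  -- to an end; the recursion is on an upper bound for this sum.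
  locally-maximal-cut : ∀ c → ∃[ c′ ] ∑ (inner c′) ≤ ∑ (inner c) × (∀ v → inner c′ v ≤ outer c′ v)
  locally-maximal-cut c = descend (∑ (inner c)) c ≤-refl
    where
    flip-< : ∀ c v → outer c v < inner c v → ∑ (inner (flip c v)) < ∑ (inner c)
    flip-< c v o<i = *-cancelˡ-< 2 _ _ (combine {2 * (∑ (inner (flip c v)) + 2 * inner c v) + 4 * suc (outer c v)}
        {2 * (∑ (inner c) + 2 * outer c v) + 4 * inner c v}
        (+-mono-≤ (*-monoʳ-≤ 2 (≤-reflexive (flip-inner c v))) (*-monoʳ-≤ 4 o<i))
        (≤-trans (m≤m+n _ 3) (≤-reflexive (lem (∑ (inner (flip c v))) (∑ (inner c)) (inner c v) (outer c v)))))
      where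
      lem : ∀ k′ k i o → suc (2 * k′) + (2 * (k + 2 * o) + 4 * i) + 3 ≡ 2 * k + (2 * (k′ + 2 * i) + 4 * suc o)
      lem = solve-∀

    descend : ∀ k c → ∑ (inner c) ≤ k → ∃[ c′ ] ∑ (inner c′) ≤ ∑ (inner c) × (∀ v → inner c′ v ≤ outer c′ v)
    descend k c K≤k with Fin.any? (λ v → outer c v <? inner c v)
    ... | no ∄v = c , ≤-refl , λ v → ≮⇒≥ λ o<i → ∄v (v , o<i)
    descend zero    c K≤k | yes (v , o<i) = contradiction (<-≤-trans (flip-< c v o<i) K≤k) λ ()
    descend (suc k) c K≤k | yes (v , o<i) =
      let c′ , K′≤ , opt = descend k (flip c v) (≤-pred (<-≤-trans (flip-< c v o<i) K≤k))
      in c′ , ≤-trans K′≤ (<⇒≤ (flip-< c v o<i)) , opt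

  -- Sizes of the sides and missing cross pairs

  -- An edge is inner or outer, and a cross pair is an outer edge or missing; both sides thus count
  -- inner edges, outer edges and missing pairs.
  degree+missing : ∀ c → ∑ degree + ∑ (missing c) ≡ ∑ (inner c) + ∑ (opposite c)
  degree+missing c = begin
    ∑ degree + ∑ (missing c)                      ≡⟨ ∑∑-+ (λ i j → ⟦ e i j ⟧) _ ⟨
    ∑∑ (λ i j → ⟦ e i j ⟧ + ⟦ not (e i j) ∧ (c i xor c j) ⟧)
      ≡⟨ ∑∑-cong (λ i j → pointwise (e i j) (c i xor c j)) ⟩
    ∑∑ (λ i j → ⟦ e i j ∧ c i ∥ c j ⟧ + ⟦ c i xor c j ⟧)
      ≡⟨ ∑∑-+ (λ i j → ⟦ e i j ∧ c i ∥ c j ⟧) _ ⟩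
    ∑ (inner c) + ∑ (opposite c)                  ∎
    where
    open ≡-Reasoning
    pointwise : ∀ x y → ⟦ x ⟧ + ⟦ not x ∧ y ⟧ ≡ ⟦ x ∧ not y ⟧ + ⟦ y ⟧
    pointwise = decide (∀-Bool? λ x → ∀-Bool? λ y → _ ≟ _)

  outer+missing : ∀ c v → outer c v + missing c v ≡ opposite c v
  outer+missing c v = trans (sym (∑-+ (λ j → ⟦ e v j ∧ (c v xor c j) ⟧) _))
    (∑-cong λ j → pointwise (e v j) (c v xor c j))
    where
    pointwise : ∀ x y → ⟦ x ∧ y ⟧ + ⟦ not x ∧ y ⟧ ≡ ⟦ y ⟧
    pointwise = decide (∀-Bool? λ x → ∀-Bool? λ y → _ ≟ _)

  -- Here `s` is the size of the side containing `v`. A pair is separated when exactly one of its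
  -- vertices lies on that side, and each such pair is counted in both orders.
  sides : ∀ c v → ∃[ s ] opposite c v + s ≡ n × ∑ (opposite c) ≡ 2 * (opposite c v * s)
  sides c v = ∑ own , trans (sym (∑-+ opp own)) (trans (∑-cong λ j → complement (c v xor c j)) (trans (∑-const n 1) (*-identityʳ n)))
            , trans (∑∑-cong λ i j → pointwise (c v) (c i) (c j))
              (trans (∑∑-+ (λ i j → opp i * own j) (λ i j → own i * opp j))
              (trans (cong₂ _+_ (∑∑-* opp own) (∑∑-* own opp)) (lem (∑ opp) (∑ own))))
    where
    opp own : Fin n → ℕ
    opp j = ⟦ c v xor c j ⟧
    own j = ⟦ c v ∥ c j ⟧

    complement : ∀ x → ⟦ x ⟧ + ⟦ not x ⟧ ≡ 1
    complement = decide (∀-Bool? λ x → _ ≟ _)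

    pointwise : ∀ x y z → ⟦ y xor z ⟧ ≡ ⟦ x xor y ⟧ * ⟦ x ∥ z ⟧ + ⟦ x ∥ y ⟧ * ⟦ x xor z ⟧
    pointwise = decide (∀-Bool? λ x → ∀-Bool? λ y → ∀-Bool? λ z → _ ≟ _)

    lem : ∀ x y → x * y + y * x ≡ 2 * (x * y)
    lem = solve-∀

  -- With sides o and s there are 2 o s ≤ n² / 2 ordered cross pairs, fewer than ordered edges;
  -- `degree+missing` turns this into the claim.
  missing<inner : ∀ c → Fin n → n * n < 2 * ∑ degree → ∑ (missing c) < ∑ (inner c)
  missing<inner c v n²<2D =
    let s , o+s≡n , Q≡2os = sides c v
    in bound (opposite c v) s n (∑ (opposite c)) (∑ degree) (∑ (missing c)) (∑ (inner c)) o+s≡n Q≡2os n²<2D (degree+missing c)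
    where
    bound : ∀ o s n Q D M K → o + s ≡ n → Q ≡ 2 * (o * s) → n * n < 2 * D → D + M ≡ K + Q → M < K
    bound o s n Q D M K refl refl p q = *-cancelˡ-< 2 M K (combine
      (+-mono-≤ (4xy≤[x+y]² o s) (+-mono-≤ p (*-monoʳ-≤ 2 (≤-reflexive q))))
      (≤-reflexive (lem o s D M K)))
      where
      lem : ∀ o s D M K → suc (2 * M) + ((o + s) * (o + s) + (2 * D + 2 * (K + 2 * (o * s)))) ≡
        2 * K + (4 * (o * s) + (suc ((o + s) * (o + s)) + 2 * (D + M)))
      lem = solve-∀

  -- With sides o and s there are (n² - (s - o)²) / 2 ordered cross pairs, and by `degree+missing`
  -- more than n² / 2 - 3 n / 4. Hence (s - o)² < 3 n / 2 ≤ z², which excludes s ≥ o + z.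
  balanced : ∀ c v z → n * n < 2 * ∑ degree → 4 * ∑ (inner c) ≤ 3 * n → 2 * n ≤ z * z →
    n ≤ z + 2 * opposite c v
  balanced c v z n²<2D 4K≤3n 2n≤z² =
    let s , o+s≡n , Q≡2os = sides c v
    in bound (opposite c v) s n (∑ (opposite c)) (∑ degree) (∑ (missing c)) (∑ (inner c)) o+s≡n Q≡2os n²<2D (degree+missing c) 4K≤3n 2n≤z²
    where
    bound : ∀ o s n Q D M K → o + s ≡ n → Q ≡ 2 * (o * s) → n * n < 2 * D → D + M ≡ K + Q →
      4 * K ≤ 3 * n → 2 * n ≤ z * z → n ≤ z + 2 * o
    bound o s n Q D M K o+s≡n refl p q r w with ≤-total n (z + 2 * o)
    ... | inj₁ n≤ = n≤
    ... | inj₂ n≥ with k , refl ← m≤n⇒∃[o]m+o≡n n≥ = contradiction (absurd s≡ o+s≡n) λ ()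
      where
      s≡ : s ≡ z + o + k
      s≡ = +-cancelˡ-≡ o _ _ (trans o+s≡n (lem o z k))
        where lem : ∀ o z k → z + 2 * o + k ≡ o + (z + o + k)
              lem = solve-∀

      absurd : s ≡ z + o + k → o + s ≡ z + 2 * o + k → 1 ≤ 0
      absurd refl _ = combine
        (+-mono-≤ (+-mono-≤ (*-monoʳ-≤ 2 p) (*-monoʳ-≤ 4 (≤-reflexive q))) (+-mono-≤ r (*-monoʳ-≤ 2 w)))
        (≤-trans (m≤m+n _ (1 + 2 * M * 2 + (z + 2 * o + k) + 2 * (2 * z * k + k * k)))
          (≤-reflexive (lem z o k D M K)))
        where
        lem : ∀ z o k D M K → let n = z + 2 * o + k; s = z + o + k in
          1 + (2 * (2 * D) + 4 * (K + 2 * (o * s)) + (3 * n + 2 * (z * z))) + (1 + 2 * M * 2 + n + 2 * (2 * z * k + k * k)) ≡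
          0 + (2 * suc (n * n) + 4 * (D + M) + (4 * K + 2 * (2 * n)))
        lem = solve-∀

  -- A vertex v whose inner degree is nearly as large as its number of missing cross edges; the
  -- latter is large because v has an inner neighbour missing few cross edges.
  dominant-vertex : ∀ c a z → 0 < n → z ≤ a → 2 * n ≤ z * z → 4 * ∑ (inner c) ≤ 3 * n →
    ∑ (missing c) < ∑ (inner c) →
    (∀ i j → e i j ∧ c i ∥ c j ≡ true → a + 4 * z ≤ z + (2 * missing c i + 2 * missing c j)) →
    ∃[ v ] a ≤ 2 * inner c v × 4 * missing c v < 4 * inner c v + z
  dominant-vertex c a z 0<n z≤a 2n≤z² 4K≤3n M<K inner-edge =
      v , a≤2i , 4m<4i+z
    where
    open ≤-Reasoning
    M = ∑ (missing c)
    K = ∑ (inner c)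
    ι μ : Fin n → Fin n → ℕ
    ι i j = ⟦ e i j ∧ c i ∥ c j ⟧
    μ i j = ⟦ not (e i j) ∧ (c i xor c j) ⟧

    ι-sym : ∀ i j → ι i j ≡ ι j i
    ι-sym i j = cong₂ (λ x y → ⟦ x ∧ not y ⟧) (e-sym i j) (Bool.xor-comm (c i) (c j))

    μ-sym : ∀ i j → μ i j ≡ μ j i
    μ-sym i j = cong₂ (λ x y → ⟦ not x ∧ y ⟧) (e-sym i j) (Bool.xor-comm (c i) (c j))

    large : Fin n → Bool
    large i = does (z ≤? missing c i)

    L : ℕ
    L = ∑ (λ i → ⟦ large i ⟧)

    weigh : ∀ (f : Fin n → Fin n → ℕ) → (∀ i j → f i j ≡ f j i) →
      ∑∑ (λ i j → ⟦ large i ⟧ * f i j + ⟦ large j ⟧ * f i j) ≡ ∑ (λ i → ⟦ large i ⟧ * (2 * ∑ (f i)))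
    weigh f f-sym = let g = λ i j → ⟦ large i ⟧ * f i j in begin-equality
      ∑∑ (λ i j → ⟦ large i ⟧ * f i j + ⟦ large j ⟧ * f i j)  ≡⟨ ∑∑-+ g (λ i j → ⟦ large j ⟧ * f i j) ⟩
      ∑∑ g + ∑∑ (λ i j → ⟦ large j ⟧ * f i j)
        ≡⟨ cong (∑∑ g +_) (trans (∑∑-cong λ i j → cong (⟦ large j ⟧ *_) (f-sym i j)) (∑∑-comm g)) ⟩
      ∑∑ g + ∑∑ g                                               ≡⟨ ∑-+ (∑ ∘ g) (∑ ∘ g) ⟨
      ∑ (λ i → ∑ (g i) + ∑ (g i))
        ≡⟨ ∑-cong (λ i → trans (cong (λ x → x + x) (∑-*ˡ ⟦ large i ⟧ (f i))) (lem ⟦ large i ⟧ (∑ (f i)))) ⟩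
      ∑ (λ i → ⟦ large i ⟧ * (2 * ∑ (f i)))                    ∎
      where lem : ∀ x y → x * y + x * y ≡ x * (2 * y)
            lem = solve-∀

    -- Every inner edge has a large end: two ends missing fewer than `z` pairs each would give a + 4
    -- z < 5 z, against z ≤ a.
    inner-≤ : K ≤ ∑ (λ i → ⟦ large i ⟧ * (2 * inner c i))
    inner-≤ = ≤-trans (∑∑-mono λ i j → pointwise i j _ refl (z ≤? missing c i) (z ≤? missing c j))
                      (≤-reflexive (weigh ι ι-sym))
      where
      pointwise : ∀ i j x → e i j ∧ c i ∥ c j ≡ x → (p : Dec (z ≤ missing c i)) (q : Dec (z ≤ missing c j)) →
        ⟦ x ⟧ ≤ ⟦ does p ⟧ * ⟦ x ⟧ + ⟦ does q ⟧ * ⟦ x ⟧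
      pointwise i j false eq p q = z≤n
      pointwise i j true eq (yes _) q = s≤s z≤n
      pointwise i j true eq (no _) (yes _) = s≤s z≤n
      pointwise i j true eq (no p) (no q) = contradiction
        (combine {x = 1} {0} (+-mono-≤ (+-mono-≤ (inner-edge i j eq) z≤a) (+-mono-≤ (*-monoʳ-≤ 2 (≰⇒> p)) (*-monoʳ-≤ 2 (≰⇒> q))))
          (≤-trans (m≤m+n _ 3) (≤-reflexive (lem a z (missing c i) (missing c j)))))
        λ ()
        where
        lem : ∀ a z x y → 1 + (z + (2 * x + 2 * y) + a + (2 * z + 2 * z)) + 3 ≡
          0 + (a + 4 * z + z + (2 * suc x + 2 * suc y))
        lem = solve-∀

    -- A missing pair is counted a second time only if both its ends are large, and there are L²
    -- ordered pairs of large vertices.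
    missing-≤ : ∑ (λ i → ⟦ large i ⟧ * (2 * missing c i)) ≤ M + L * L
    missing-≤ = begin
      ∑ (λ i → ⟦ large i ⟧ * (2 * missing c i))                 ≡⟨ weigh μ μ-sym ⟨
      ∑∑ (λ i j → ⟦ large i ⟧ * μ i j + ⟦ large j ⟧ * μ i j)
        ≤⟨ ∑∑-mono (λ i j → pointwise (large i) (large j) (not (e i j) ∧ (c i xor c j))) ⟩
      ∑∑ (λ i j → μ i j + ⟦ large i ⟧ * ⟦ large j ⟧)            ≡⟨ ∑∑-+ μ (λ i j → ⟦ large i ⟧ * ⟦ large j ⟧) ⟩
      M + ∑∑ (λ i j → ⟦ large i ⟧ * ⟦ large j ⟧)
        ≡⟨ cong (M +_) (∑∑-* (λ i → ⟦ large i ⟧) (λ i → ⟦ large i ⟧)) ⟩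
      M + L * L                                                  ∎
      where
      pointwise : ∀ x y m → ⟦ x ⟧ * ⟦ m ⟧ + ⟦ y ⟧ * ⟦ m ⟧ ≤ ⟦ m ⟧ + ⟦ x ⟧ * ⟦ y ⟧
      pointwise = decide (∀-Bool? λ x → ∀-Bool? λ y → ∀-Bool? λ m → _ ≤? _)

    -- The surplus L² is spread over the large vertices as `L` each, so that one of them has 2
    -- missing < 2 inner + L.
    exceeds : ∑ (λ i → ⟦ large i ⟧ * (2 * missing c i)) < ∑ (λ i → ⟦ large i ⟧ * (2 * inner c i + L))
    exceeds = begin-strict
      ∑ (λ i → ⟦ large i ⟧ * (2 * missing c i))            ≤⟨ missing-≤ ⟩
      M + L * L                                             <⟨ +-monoˡ-< (L * L) M<K ⟩
      K + L * L                                             ≤⟨ +-monoˡ-≤ (L * L) inner-≤ ⟩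
      ∑ (λ i → ⟦ large i ⟧ * (2 * inner c i)) + L * L
        ≡⟨ cong (∑ (λ i → ⟦ large i ⟧ * (2 * inner c i)) +_) (∑-*ʳ L (λ i → ⟦ large i ⟧)) ⟨
      ∑ (λ i → ⟦ large i ⟧ * (2 * inner c i)) + ∑ (λ i → ⟦ large i ⟧ * L)
        ≡⟨ ∑-+ (λ i → ⟦ large i ⟧ * (2 * inner c i)) (λ i → ⟦ large i ⟧ * L) ⟨
      ∑ (λ i → ⟦ large i ⟧ * (2 * inner c i) + ⟦ large i ⟧ * L)
        ≡⟨ ∑-cong (λ i → *-distribˡ-+ ⟦ large i ⟧ (2 * inner c i) L) ⟨
      ∑ (λ i → ⟦ large i ⟧ * (2 * inner c i + L))          ∎

    few : L * z ≤ M
    few = ≤-trans (≤-reflexive (sym (∑-*ʳ z (λ i → ⟦ large i ⟧))))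
            (∑-mono λ i → ⟦⟧*-≤ (z ≤? missing c i) id)

    2M<z² : 2 * M < z * z
    2M<z² = *-cancelˡ-< 2 _ _ (combine
      (+-mono-≤ (*-monoʳ-≤ 4 M<K) (+-mono-≤ 4K≤3n (*-monoʳ-≤ 2 2n≤z²)))
      (≤-trans (m≤m+n _ (3 + n)) (≤-reflexive (lem M K n z))))
      where lem : ∀ M K n z → suc (2 * (2 * M)) + (4 * K + (3 * n + 2 * (z * z))) + (3 + n) ≡
                    2 * (z * z) + (4 * suc M + (4 * K + 2 * (2 * n)))
            lem = solve-∀

    -- Each large vertex misses at least `z` pairs, so L z ≤ M < z² / 2.
    2L<z : 2 * L < z
    2L<z = *-cancelʳ-< z (2 * L) z (≤-<-trans (≤-trans (≤-reflexive (*-assoc 2 L z)) (*-monoʳ-≤ 2 few)) 2M<z²)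

    ∃v = ∑-<⇒∃ (λ i → ⟦ large i ⟧ * (2 * missing c i)) (λ i → ⟦ large i ⟧ * (2 * inner c i + L)) exceeds
    v  = proj₁ ∃v

    at-v : z ≤ missing c v × 2 * missing c v < 2 * inner c v + L
    at-v = select (z ≤? missing c v) (proj₂ ∃v)
      where
      -- If `v` were not large, both sides of the strict inequality would be 0.
      select : (p : Dec (z ≤ missing c v)) → ⟦ does p ⟧ * (2 * missing c v) < ⟦ does p ⟧ * (2 * inner c v + L) →
        z ≤ missing c v × 2 * missing c v < 2 * inner c v + L
      select (yes p) lt = p , subst₂ _<_ (*-identityˡ _) (*-identityˡ _) lt

    z≤2i : z ≤ 2 * inner c v
    z≤2i = *-cancelˡ-≤ 2 (combine
      (+-mono-≤ (*-monoʳ-≤ 4 (proj₁ at-v)) (+-mono-≤ (*-monoʳ-≤ 2 (proj₂ at-v)) 2L<z))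
      (≤-trans (m≤m+n _ (3 + z)) (≤-reflexive (lem z (missing c v) (inner c v) L))))
      where lem : ∀ z m i l → 2 * z + (4 * m + (2 * (2 * i + l) + z)) + (3 + z) ≡
                    2 * (2 * i) + (4 * z + (2 * suc (2 * m) + suc (2 * l)))
            lem = solve-∀

    -- As M < z² / 2 ≤ z · inner c v, the inner neighbours of `v` cannot all be large; `w` is one
    -- that is not.
    M<iz : ∑ (missing c) < ∑ (λ j → ι v j * z)
    M<iz = *-cancelˡ-< 2 _ _ (<-≤-trans 2M<z² (≤-trans (*-monoˡ-≤ z z≤2i) (≤-reflexive
      (trans (*-assoc 2 (inner c v) z) (cong (2 *_) (sym (∑-*ʳ z (ι v))))))))

    ∃w = ∑-<⇒∃ (missing c) (λ j → ι v j * z) M<iz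
    w  = proj₁ ∃w

    at-w : e v w ∧ c v ∥ c w ≡ true × missing c w < z
    at-w = select _ refl (proj₂ ∃w)
      where
      select : ∀ x → e v w ∧ c v ∥ c w ≡ x → missing c w < ⟦ x ⟧ * z → e v w ∧ c v ∥ c w ≡ true × missing c w < z
      select true eq lt = eq , subst (missing c w <_) (*-identityˡ z) lt

    -- On the edge vw, missing c w < z leaves 2 · missing c v ≥ a + z, and passing to the inner
    -- degree costs at most L < z.
    a≤2i : a ≤ 2 * inner c v
    a≤2i = combine
      (+-mono-≤ (+-mono-≤ (inner-edge v w (proj₁ at-w)) (*-monoʳ-≤ 2 (proj₂ at-w)))
                (+-mono-≤ (proj₂ at-v) 2L<z))
      (≤-trans (m≤m+n _ (4 + L)) (≤-reflexive (lem a z (missing c v) (missing c w) (inner c v) L)))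
      where lem : ∀ a z m m′ i l → a + (z + (2 * m + 2 * m′) + 2 * z + (2 * i + l + z)) + (4 + l) ≡
                    2 * i + (a + 4 * z + 2 * suc m′ + (suc (2 * m) + suc (2 * l)))
            lem = solve-∀

    4m<4i+z : 4 * missing c v < 4 * inner c v + z
    4m<4i+z = combine (+-mono-≤ (*-monoʳ-≤ 2 (proj₂ at-v)) 2L<z)
      (≤-trans (m≤m+n _ 2) (≤-reflexive (lem z (missing c v) (inner c v) L)))
      where lem : ∀ z m i l → suc (4 * m) + (2 * (2 * i + l) + z) + 2 ≡ 4 * i + z + (2 * suc (2 * m) + suc (2 * l))
            lem = solve-∀

  -- Books, missing pairs and triangles

  -- The ends of an inner edge face the same side, and each vertex there is a common neighbour or
  -- forms a missing pair with one of them.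
  opposite-≤ : ∀ c u w b → ∑ (λ k → ⟦ e u k ⟧ * ⟦ e w k ⟧) ≤ b → e u w ∧ c u ∥ c w ≡ true →
    opposite c u ≤ b + (missing c u + missing c w)
  opposite-≤ c u w b codeg≤b uw = begin
    opposite c u
      ≤⟨ ∑-mono (λ j → pointwise (e u w) (c u) (c w) (c j) (e u j) (e w j) uw) ⟩
    ∑ (λ j → ⟦ e u j ⟧ * ⟦ e w j ⟧ + (⟦ not (e u j) ∧ (c u xor c j) ⟧ + ⟦ not (e w j) ∧ (c w xor c j) ⟧))
      ≡⟨ trans (∑-+ (λ j → ⟦ e u j ⟧ * ⟦ e w j ⟧) _)
           (cong (∑ (λ j → ⟦ e u j ⟧ * ⟦ e w j ⟧) +_) (∑-+ (λ j → ⟦ not (e u j) ∧ (c u xor c j) ⟧) _)) ⟩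
    ∑ (λ j → ⟦ e u j ⟧ * ⟦ e w j ⟧) + (missing c u + missing c w)
      ≤⟨ +-monoˡ-≤ _ codeg≤b ⟩
    b + (missing c u + missing c w) ∎
    where
    open ≤-Reasoning
    pointwise : ∀ d x y j p q → d ∧ x ∥ y ≡ true →
      ⟦ x xor j ⟧ ≤ ⟦ p ⟧ * ⟦ q ⟧ + (⟦ not p ∧ (x xor j) ⟧ + ⟦ not q ∧ (y xor j) ⟧)
    pointwise = decide (∀-Bool? λ d → ∀-Bool? λ x → ∀-Bool? λ y → ∀-Bool? λ j → ∀-Bool? λ p → ∀-Bool? λ q →
      (_ Bool.≟ _) →-dec (_ ≤? _))

  -- An inner and an outer neighbour of `v` lie on different sides: they are adjacent and span a
  -- triangle with `v`, or they form a missing pair.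
  inner*outer-≤ : ∀ c v t → triangles-at v ≤ 2 * t → inner c v * outer c v ≤ t + ∑ (missing c)
  inner*outer-≤ c v t T≤2t = begin
    inner c v * outer c v
      ≡⟨ ∑∑-* (λ j → ⟦ e v j ∧ c v ∥ c j ⟧) (λ k → ⟦ e v k ∧ (c v xor c k) ⟧) ⟨
    ∑∑ (λ j k → ⟦ e v j ∧ c v ∥ c j ⟧ * ⟦ e v k ∧ (c v xor c k) ⟧)
      ≤⟨ ∑∑-mono (λ j k → adjacent-or-missing (c v) (c j) (c k) (e v j) (e v k) (e j k)) ⟩
    ∑∑ (λ j k → f j k + ⟦ not (e j k) ∧ (c j xor c k) ⟧)
      ≡⟨ ∑∑-+ f _ ⟩
    ∑∑ f + ∑ (missing c)
      ≤⟨ +-monoˡ-≤ (∑ (missing c)) (*-cancelˡ-≤ {∑∑ f} {t} 2 (≤-trans doubled T≤2t)) ⟩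
    t + ∑ (missing c) ∎
    where
    open ≤-Reasoning
    f : Fin n → Fin n → ℕ
    f j k = ⟦ (e v j ∧ e v k ∧ e j k) ∧ (c v ∥ c j ∧ (c v xor c k)) ⟧

    adjacent-or-missing : ∀ x y z p q r → ⟦ p ∧ x ∥ y ⟧ * ⟦ q ∧ (x xor z) ⟧ ≤
      ⟦ (p ∧ q ∧ r) ∧ (x ∥ y ∧ (x xor z)) ⟧ + ⟦ not r ∧ (y xor z) ⟧
    adjacent-or-missing = decide (∀-Bool? λ x → ∀-Bool? λ y → ∀-Bool? λ z →
      ∀-Bool? λ p → ∀-Bool? λ q → ∀-Bool? λ r → _ ≤? _)

    -- Only one of the two neighbours can be on the side of `v`, so `f` holds for at most one order
    -- of a pair that `triangles-at` counts in both.
    either-order : ∀ x y z p q r →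
      ⟦ (p ∧ q ∧ r) ∧ (x ∥ y ∧ (x xor z)) ⟧ + ⟦ (q ∧ p ∧ r) ∧ (x ∥ z ∧ (x xor y)) ⟧ ≤ ⟦ p ⟧ * (⟦ q ⟧ * ⟦ r ⟧)
    either-order = decide (∀-Bool? λ x → ∀-Bool? λ y → ∀-Bool? λ z →
      ∀-Bool? λ p → ∀-Bool? λ q → ∀-Bool? λ r → _ ≤? _)

    doubled : 2 * ∑∑ f ≤ triangles-at v
    doubled = begin
      2 * ∑∑ f                          ≡⟨ cong (∑∑ f +_) (+-identityʳ (∑∑ f)) ⟩
      ∑∑ f + ∑∑ f                       ≡⟨ cong (∑∑ f +_) (∑∑-comm f) ⟨
      ∑∑ f + ∑∑ (λ j k → f k j)         ≡⟨ ∑∑-+ f (λ j k → f k j) ⟨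
      ∑∑ (λ j k → f j k + f k j)
        ≡⟨ ∑∑-cong (λ j k → cong (λ x → f j k + ⟦ (e v k ∧ e v j ∧ x) ∧ (c v ∥ c k ∧ (c v xor c j)) ⟧) (e-sym k j)) ⟩
      ∑∑ (λ j k → f j k + ⟦ (e v k ∧ e v j ∧ e j k) ∧ (c v ∥ c k ∧ (c v xor c j)) ⟧)
        ≤⟨ ∑∑-mono (λ j k → either-order (c v) (c j) (c k) (e v j) (e v k) (e j k)) ⟩
      triangles-at v                    ∎

  -- The error scale is `z`, and `a` bounds twice the inner degree p of the dominant vertex from
  -- below. With q its outer degree, `rectangle` gives 4 p q ≥ a n - a (a + 2 z), whereas 4 p q is
  -- at most 4 t plus four times the missing sum, which is below 3 n.
  many-triangles : ∀ a b t z → 0 < n → z ≤ a → 2 * n ≤ z * z → n * n < 2 * ∑ degree →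
    ∑ triangles-at ≤ 6 * t → (∀ v → triangles-at v ≤ 2 * t) → 16 * t ≤ n * n →
    (∀ u w → e u w ≡ true → ∑ (λ k → ⟦ e u k ⟧ * ⟦ e w k ⟧) ≤ b) →
    a + 4 * z + 2 * b ≤ n →
    a * n ≤ 4 * t + 4 * n + a * (a + 2 * z)
  many-triangles a b t z 0<n z≤a 2n≤z² n²<2D T≤6t T≤2t 16t≤n² codeg≤b Λ+2b≤n =
    let u , 4K₀≤3n     = sparse-cut t 0<n (<⇒≤ n²<2D) T≤6t 16t≤n²
        c , K≤K₀ , opt = locally-maximal-cut (e u)
        4K≤3n          = ≤-trans (*-monoʳ-≤ 4 K≤K₀) 4K₀≤3n
        M<K            = missing<inner c u n²<2D
        v , a≤2i , 4m<4i+z = dominant-vertex c a z 0<n z≤a 2n≤z² 4K≤3n M<K λ i j ij →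
          inner-edge {opposite c i} {missing c i} {missing c j} (opposite-≤ c i j b (codeg≤b i j (∧-trueˡ _ _ ij)) ij) (balanced c i z n²<2D 4K≤3n 2n≤z²)
    in conclude (inner c v) (outer c v) (missing c v) (opposite c v) (∑ (missing c)) (∑ (inner c)) a≤2i (opt v) 4m<4i+z
         (outer+missing c v) (balanced c v z n²<2D 4K≤3n 2n≤z²) (inner*outer-≤ c v t (T≤2t v)) M<K 4K≤3n
    where
    ∧-trueˡ : ∀ x y → x ∧ y ≡ true → x ≡ true
    ∧-trueˡ true _ _ = refl

    -- a + 4 z ≤ n - 2 b ≤ z + 2 o - 2 b ≤ z + 2 m + 2 m′.
    inner-edge : ∀ {o m m′} → o ≤ b + (m + m′) → n ≤ z + 2 * o → a + 4 * z ≤ z + (2 * m + 2 * m′)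
    inner-edge {o} {m} {m′} p q = combine (+-mono-≤ (+-mono-≤ (*-monoʳ-≤ 2 p) q) Λ+2b≤n)
      (≤-reflexive (lem o m m′ a b n z))
      where lem : ∀ o m m′ a b n z → a + 4 * z + (2 * (b + (m + m′)) + (z + 2 * o) + n) ≡
                    z + (2 * m + 2 * m′) + (2 * o + n + (a + 4 * z + 2 * b))
            lem = solve-∀

    -- (P − a) (Q − a) ≥ 0, to be applied to twice the inner and outer degree of the dominant vertex.
    rectangle : ∀ P Q → a ≤ P → P ≤ Q → n ≤ P + Q + 2 * z → a * n ≤ P * Q + a * (a + 2 * z)
    rectangle P Q a≤P P≤Q n≤ with x , refl ← m≤n⇒∃[o]m+o≡n a≤P with y , refl ← m≤n⇒∃[o]m+o≡n P≤Q =
      combine (*-monoʳ-≤ a n≤) (≤-trans (m≤m+n _ (x * x + x * y)) (≤-reflexive (lem a n x y z)))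
      where
      lem : ∀ a n x y z → a * n + a * (a + x + (a + x + y) + 2 * z) + (x * x + x * y) ≡
            (a + x) * (a + x + y) + a * (a + 2 * z) + a * n
      lem = solve-∀

    conclude : ∀ p q m o M K → a ≤ 2 * p → p ≤ q → 4 * m < 4 * p + z → q + m ≡ o → n ≤ z + 2 * o →
      p * q ≤ t + M → M < K → 4 * K ≤ 3 * n → a * n ≤ 4 * t + 4 * n + a * (a + 2 * z)
    conclude p q m o M K a≤2p p≤q 4m< refl n≤ pq≤ M<K 4K≤3n = combine
      (+-mono-≤ (+-mono-≤ (rectangle (2 * p) (2 * q) a≤2p (*-monoʳ-≤ 2 p≤q) n≤2p+2q+2z) (*-monoʳ-≤ 4 pq≤)) (+-mono-≤ (*-monoʳ-≤ 4 M<K) 4K≤3n))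
      (≤-trans (m≤m+n _ (4 + n)) (≤-reflexive (lem a n p q t M K z)))
      where
      -- As 2 m < 2 p + z / 2, the balance n ≤ z + 2 (q + m) gives n < 2 p + 2 q + 3 z / 2.
      n≤2p+2q+2z : n ≤ 2 * p + 2 * q + 2 * z
      n≤2p+2q+2z = *-cancelˡ-≤ 2 (combine (+-mono-≤ (*-monoʳ-≤ 2 n≤) 4m<)
        (≤-trans (m≤m+n _ (1 + z)) (≤-reflexive (lem′ n p q m z))))
        where lem′ : ∀ n p q m z → 2 * n + (2 * (z + 2 * (q + m)) + (4 * p + z)) + (1 + z) ≡
                      2 * (2 * p + 2 * q + 2 * z) + (2 * n + suc (4 * m))
              lem′ = solve-∀
      lem : ∀ a n p q t M K z →
        a * n + (2 * p * (2 * q) + a * (a + 2 * z) + 4 * (t + M) + (4 * K + 3 * n)) + (4 + n) ≡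
        4 * t + 4 * n + a * (a + 2 * z) + (a * n + 4 * (p * q) + (4 * suc M + 4 * K))
      lem = solve-∀

-- Here z = ⌊n / r⌋ plays the role of the o(n) error term, and the threshold a + 4 z is P z ≈ (P / r) n.
triangles-discrete : ∀ {n} (G : Graph n) P r → 5 ≤ P → P ≤ r → 4 * (r * r) ≤ n → 0 < n →
  n * n / 4 + 1 ≤ edgeCount G → 16 * t G ≤ n * n → 2 * (b G * r) + P * n ≤ r * n →
  r * P * (n * n) ≤ P * P * (n * n) + 4 * (r * r) * t G + 6 * r * (n * n)
triangles-discrete {n} G P r 5≤P P≤r 4r²≤n 0<n edges≥ 16t≤n² 2br+Pn≤rn
  -- P = 5 + P′ makes a = (P - 4) z at least `z`.
  with P′ , refl ← m≤n⇒∃[o]m+o≡n 5≤P = scale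
  where
  open Graph G
  open Counting G
  open Cuts e e-sym e-irrefl

  instance
    r≢0 : NonZero r
    r≢0 = >-nonZero (≤-trans (s≤s z≤n) P≤r)

  z = n / r
  a = suc P′ * z

  rz≤n : r * z ≤ n
  rz≤n = ≤-trans (≤-reflexive (*-comm r z)) (m/n*n≤m n r)

  n≤rz+r : n ≤ r * z + r
  n≤rz+r = begin
    n              ≡⟨ m≡m%n+[m/n]*n n r ⟩
    n % r + z * r  ≤⟨ +-monoˡ-≤ (z * r) (<⇒≤ (m%n<n n r)) ⟩
    r + z * r      ≡⟨ trans (+-comm r (z * r)) (cong (_+ r) (*-comm z r)) ⟩
    r * z + r      ∎
    where open ≤-Reasoning

  4r≤z : 4 * r ≤ z
  4r≤z = ≤-trans (≤-reflexive (trans (sym (m*n/n≡m (4 * r) r)) (cong (_/ r) (*-assoc 4 r r)))) (/-monoˡ-≤ r 4r²≤n)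

  1≤r : 1 ≤ r
  1≤r = ≤-trans (s≤s z≤n) P≤r

  r≤z : r ≤ z
  r≤z = ≤-trans (m≤n*m r 4) 4r≤z

  -- 2 n ≤ 2 r z + 2 r ≤ 4 r z ≤ z².
  2n≤z² : 2 * n ≤ z * z
  2n≤z² = combine (+-mono-≤ (*-monoʳ-≤ 2 n≤rz+r) (+-mono-≤ (*-monoˡ-≤ z 4r≤z) (*-monoʳ-≤ (2 * r) (≤-trans 1≤r r≤z))))
    (≤-reflexive (lem n r z))
    where lem : ∀ n r z → 2 * n + (2 * (r * z + r) + (z * z + 2 * r * z)) ≡ z * z + (2 * n + (4 * r * z + 2 * r * 1))
          lem = solve-∀

  -- Strict because n² < 4 (⌊n² / 4⌋ + 1): the one extra edge outweighs the rounding.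
  n²<2D : n * n < 2 * ∑ degree
  n²<2D = begin-strict
    n * n                          ≡⟨ m≡m%n+[m/n]*n (n * n) 4 ⟩
    n * n % 4 + n * n / 4 * 4      <⟨ +-monoˡ-< (n * n / 4 * 4) (m%n<n (n * n) 4) ⟩
    4 + n * n / 4 * 4              ≡⟨ lem (n * n / 4) ⟩
    4 * (n * n / 4 + 1)            ≤⟨ *-monoʳ-≤ 4 edges≥ ⟩
    4 * edgeCount G                ≡⟨ lem′ (edgeCount G) ⟩
    2 * (edgeCount G + edgeCount G) ≤⟨ *-monoʳ-≤ 2 edges-≤ ⟩
    2 * ∑ degree                   ∎
    where
    open ≤-Reasoning
    lem : ∀ x → 4 + x * 4 ≡ 4 * (x + 1)
    lem = solve-∀
    lem′ : ∀ x → 4 * x ≡ 2 * (x + x)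
    lem′ = solve-∀

  -- r (P z + 2 b) ≤ P n + 2 b r ≤ r n.
  threshold : a + 4 * z + 2 * b G ≤ n
  threshold = *-cancelˡ-≤ r (combine (+-mono-≤ 2br+Pn≤rn (*-monoʳ-≤ (5 + P′) rz≤n)) (≤-reflexive (lem P′ r z n (b G))))
    where lem : ∀ P r z n b → r * (suc P * z + 4 * z + 2 * b) + (r * n + (5 + P) * n) ≡
                  r * n + (2 * (b * r) + (5 + P) * n + (5 + P) * (r * z))
          lem = solve-∀

  adjacent : ∀ {u w} → e u w ≡ true → u ~ w
  adjacent {u} {w} eq with yes p ← u ~? w = p

  key : a * n ≤ 4 * t G + 4 * n + a * (a + 2 * z)
  key = many-triangles a (b G) (t G) z 0<n (m≤n*m z (suc P′)) 2n≤z² n²<2D ∑∑∑ordered-≤ ∑∑ordered-≤ 16t≤n²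
    (λ u w uw → codegree≤b (adjacent uw)) threshold

  -- This is r² times `key` with r z traded for n. The error 6 r n² consists of 4 r n² for replacing
  -- `a` by P z and 2 r n² for the terms of lower order, which 4 r² ≤ n controls.
  scale : r * (5 + P′) * (n * n) ≤ (5 + P′) * (5 + P′) * (n * n) + 4 * (r * r) * t G + 6 * r * (n * n)
  scale = combine
    (+-mono-≤ (+-mono-≤ (+-mono-≤ (*-monoʳ-≤ (r * r) key) (*-monoʳ-≤ (4 * r * n) rz≤n))
                        (+-mono-≤ (*-monoʳ-≤ (r * (5 + P′) * n) n≤rz+r)
                                  (*-monoʳ-≤ ((5 + P′) * (5 + P′)) (*-mono-≤ rz≤n rz≤n))))
              (+-mono-≤ (*-monoʳ-≤ (n * (1 + r)) 4r²≤n)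
                        (+-mono-≤ (*-monoʳ-≤ (n * n) 1≤r) (*-monoʳ-≤ (r * r * n) P≤r))))
    (≤-trans (m≤m+n _ ((6 * P′ + 22) * (r * r) * (z * z) + 3 * (r * r * r) * n))
      (≤-reflexive (lem P′ r z n (t G))))
    where
    lem : ∀ p r z n t → let P = 5 + p; a = suc p * z in
      r * P * (n * n)
        + (r * r * (4 * t + 4 * n + a * (a + 2 * z)) + 4 * r * n * n + (r * P * n * (r * z + r) + P * P * (n * n))
        + (n * (1 + r) * n + (n * n * r + r * r * n * r)))
        + ((6 * p + 22) * (r * r) * (z * z) + 3 * (r * r * r) * n)
      ≡ P * P * (n * n) + 4 * (r * r) * t + 6 * r * (n * n)
        + (r * r * (a * n) + 4 * r * n * (r * z) + (r * P * n * n + P * P * (r * z * (r * z)))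
        + (n * (1 + r) * (4 * (r * r)) + (n * n * 1 + r * r * n * P)))
    lem = solve-∀

-- From the integers to the reals

open import Data.Integer.Base as ℤ using (+_)
import Data.Integer.Properties as ℤ
open import Data.Rational.Base using (ℚ; mkℚ; ½; 0ℚ; 1ℚ; fromℚᵘ; *≤*; *<*; Positive; positive; nonNegative; ∣_∣; _⊓_)
  renaming (_/_ to _/ℚ_; _+_ to _+ℚ_; _*_ to _*ℚ_; -_ to -ℚ_; _-_ to _-ℚ_; _≤_ to _≤ℚ_; _<_ to _<ℚ_)
import Data.Rational.Properties as ℚ
open import Data.Rational.Solver using (module +-*-Solver)
open import Data.Rational.Unnormalised.Base as ℚᵘ using (mkℚᵘ; *≡*)
import Data.Rational.Unnormalised.Properties as ℚᵘ

combineℚ : ∀ {a b x y} → a ≤ℚ b → x +ℚ b ≤ℚ y +ℚ a → x ≤ℚ y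
combineℚ {a} {b} {x} {y} a≤b p = begin
  x                      ≡⟨ cancel x b ⟨
  x +ℚ b +ℚ (-ℚ b)       ≤⟨ ℚ.+-monoˡ-≤ (-ℚ b) (ℚ.≤-trans p (ℚ.+-monoʳ-≤ y a≤b)) ⟩
  y +ℚ b +ℚ (-ℚ b)       ≡⟨ cancel y b ⟩
  y                      ∎
  where
  open ℚ.≤-Reasoning
  open +-*-Solver
  cancel : ∀ x b → x +ℚ b +ℚ (-ℚ b) ≡ x
  cancel = solve 2 (λ x b → x :+ b :+ (:- b) := x) refl

p≤∣p∣ : ∀ p → p ≤ℚ ∣ p ∣
p≤∣p∣ p with ℚ.∣p∣≡p∨∣p∣≡-p p
... | inj₁ ∣p∣≡p  = ℚ.≤-reflexive (sym ∣p∣≡p)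
... | inj₂ ∣p∣≡-p = ℚ.≤-trans p≤0 (ℚ.0≤∣p∣ p)
  where
  open +-*-Solver
  p≤0 : p ≤ℚ 0ℚ
  p≤0 = combineℚ (subst (0ℚ ≤ℚ_) ∣p∣≡-p (ℚ.0≤∣p∣ p))
    (ℚ.≤-reflexive (solve 1 (λ p → p :+ (:- p) := con 0ℚ :+ con 0ℚ) refl p))

fromℚᵘ-+ : ∀ p q → fromℚᵘ (p ℚᵘ.+ q) ≡ fromℚᵘ p +ℚ fromℚᵘ q
fromℚᵘ-+ p q = ℚ.toℚᵘ-injective (ℚᵘ.≃-trans (ℚ.toℚᵘ-fromℚᵘ (p ℚᵘ.+ q)) (ℚᵘ.≃-sym
  (ℚᵘ.≃-trans (ℚ.toℚᵘ-homo-+ (fromℚᵘ p) (fromℚᵘ q)) (ℚᵘ.+-cong (ℚ.toℚᵘ-fromℚᵘ p) (ℚ.toℚᵘ-fromℚᵘ q)))))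

fromℚᵘ-* : ∀ p q → fromℚᵘ (p ℚᵘ.* q) ≡ fromℚᵘ p *ℚ fromℚᵘ q
fromℚᵘ-* p q = ℚ.toℚᵘ-injective (ℚᵘ.≃-trans (ℚ.toℚᵘ-fromℚᵘ (p ℚᵘ.* q)) (ℚᵘ.≃-sym
  (ℚᵘ.≃-trans (ℚ.toℚᵘ-homo-* (fromℚᵘ p) (fromℚᵘ q)) (ℚᵘ.*-cong (ℚ.toℚᵘ-fromℚᵘ p) (ℚ.toℚᵘ-fromℚᵘ q)))))

-- The value of the constant sequence behind `fromℕ`.
ι : ℕ → ℚ
ι n = + n /ℚ 1

ι-+ : ∀ m n → ι (m + n) ≡ ι m +ℚ ι n
ι-+ m n = trans
  (cong (λ k → fromℚᵘ (mkℚᵘ k 0)) (trans (ℤ.pos-+ m n) (sym (cong₂ ℤ._+_ (ℤ.*-identityʳ (+ m)) (ℤ.*-identityʳ (+ n))))))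
  (fromℚᵘ-+ (mkℚᵘ (+ m) 0) (mkℚᵘ (+ n) 0))

ι-* : ∀ m n → ι (m * n) ≡ ι m *ℚ ι n
ι-* m n = trans (cong (λ k → fromℚᵘ (mkℚᵘ k 0)) (ℤ.pos-* m n)) (fromℚᵘ-* (mkℚᵘ (+ m) 0) (mkℚᵘ (+ n) 0))

/-split : ∀ m d → + m /ℚ suc d ≡ ι m *ℚ (+ 1 /ℚ suc d)
/-split m d = trans
  (ℚ.fromℚᵘ-cong {mkℚᵘ (+ m) d} {mkℚᵘ (+ m) 0 ℚᵘ.* mkℚᵘ (+ 1) d}
    (*≡* (cong₂ ℤ._*_ (sym (ℤ.*-identityʳ (+ m))) (cong (λ k → + suc k) (+-identityʳ d)))))
  (fromℚᵘ-* (mkℚᵘ (+ m) 0) (mkℚᵘ (+ 1) d))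

0≤ι : ∀ n → 0ℚ ≤ℚ ι n
0≤ι n = ℚ.nonNegative⁻¹ (ι n) {{ℚ.normalize-nonNeg n 1}}

ι-mono : ∀ m n → m ≤ n → ι m ≤ℚ ι n
ι-mono m n m≤n with k , refl ← m≤n⇒∃[o]m+o≡n m≤n =
  ℚ.≤-trans (ℚ.≤-reflexive (sym (ℚ.+-identityʳ (ι m))))
    (ℚ.≤-trans (ℚ.+-monoʳ-≤ (ι m) (0≤ι k)) (ℚ.≤-reflexive (sym (ι-+ m k))))

ι-cancel : ∀ m n → ι m ≤ℚ ι n → m ≤ n
ι-cancel m n p = ≮⇒≥ λ n<m → contradiction
  (combineℚ {x = 1ℚ} {0ℚ} (ℚ.≤-trans (ι-mono (suc n) m n<m) p)
    (ℚ.≤-reflexive (trans (sym (ι-+ 1 n)) (sym (ℚ.+-identityˡ (ι (suc n)))))))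
  λ { (*≤* (ℤ.+≤+ ())) }

ι-pos : ∀ n → 0 < n → Positive (ι n)
ι-pos (suc n) _ = ℚ.normalize-pos (suc n) 1

*-monoˡ-≤ℚ : ∀ {r p q} → 0ℚ ≤ℚ r → p ≤ℚ q → r *ℚ p ≤ℚ r *ℚ q
*-monoˡ-≤ℚ {r} 0≤r = ℚ.*-monoˡ-≤-nonNeg r {{nonNegative 0≤r}}

0≤* : ∀ {p q} → 0ℚ ≤ℚ p → 0ℚ ≤ℚ q → 0ℚ ≤ℚ p *ℚ q
0≤* {p} {q} 0≤p 0≤q = ℚ.nonNegative⁻¹ (p *ℚ q) {{ℚ.nonNeg*nonNeg⇒nonNeg p {{nonNegative 0≤p}} q {{nonNegative 0≤q}}}}

0<* : ∀ {p q} → 0ℚ <ℚ p → 0ℚ <ℚ q → 0ℚ <ℚ p *ℚ q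
0<* {p} {q} 0<p 0<q = ℚ.positive⁻¹ (p *ℚ q) {{ℚ.pos*pos⇒pos p {{positive 0<p}} q {{positive 0<q}}}}

as-ratio : ∀ p → 0ℚ <ℚ p → ∃[ m ] ∃[ d ] 0 < m × 0 < d × p *ℚ ι d ≡ ι m
as-ratio p@(mkℚ (+ suc m) d _) 0<p = suc m , suc d , s≤s z≤n , s≤s z≤n ,
  trans (cong (_*ℚ ι (suc d)) (sym (ℚ.↥p/↧p≡p p)))
    (trans (sym (fromℚᵘ-* (mkℚᵘ (+ suc m) d) (mkℚᵘ (+ suc d) 0)))
      (ℚ.fromℚᵘ-cong {mkℚᵘ (+ suc m) d ℚᵘ.* mkℚᵘ (+ suc d) 0} {mkℚᵘ (+ suc m) 0}
        (*≡* (trans (ℤ.*-identityʳ _) (cong (λ k → + suc m ℤ.* + suc k) (sym (*-identityʳ d)))))))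
as-ratio (mkℚ (+ zero) _ _) (*<* (ℤ.+<+ ()))
as-ratio (mkℚ (ℤ.-[1+ _ ]) _ _) (*<* ())

square≥0 : ∀ x → 0ℚ ≤ℚ x *ℚ x
square≥0 x with ℚ.≤-total 0ℚ x
... | inj₁ 0≤x = 0≤* 0≤x 0≤x
... | inj₂ x≤0 = subst (0ℚ ≤ℚ_) (solve 1 (λ x → (:- x) :* (:- x) := x :* x) refl x)
                   (0≤* (ℚ.neg-antimono-≤ x≤0) (ℚ.neg-antimono-≤ x≤0))
  where open +-*-Solver

-- Densities with rational parameters

-- β (1 - β) ≤ 1 / 4, in the form (2 β - 1)² ≥ 0.
many-triangles-density : ∀ β ε N T → 0ℚ ≤ℚ ε → N *ℚ N ≤ℚ ι 16 *ℚ T →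
  (β *ℚ (1ℚ -ℚ β) -ℚ ε) *ℚ (N *ℚ N *ℚ (+ 1 /ℚ 4)) ≤ℚ T
many-triangles-density β ε N T 0≤ε N²≤16T = ℚ.*-cancelˡ-≤-pos (ι 16)
  (combineℚ (ℚ.+-mono-≤ N²≤16T (0≤* (square≥0 N) (ℚ.+-mono-≤ (square≥0 (ι 2 *ℚ β -ℚ 1ℚ)) (0≤* (0≤ι 4) 0≤ε))))
    (ℚ.≤-reflexive (solve 4 (λ β ε N T →
      con (ι 16) :* ((β :* (con 1ℚ :- β) :- ε) :* (N :* N :* con (+ 1 /ℚ 4)))
        :+ (con (ι 16) :* T :+ N :* N :* ((con (ι 2) :* β :- con 1ℚ) :* (con (ι 2) :* β :- con 1ℚ) :+ con (ι 4) :* ε))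
      := con (ι 16) :* T :+ (N :* N :+ con 0ℚ)) refl β ε N T)))
  where open +-*-Solver

-- Division by 4 R² yields the density bound with β = Q / R; the error 6 R N² is at most ε R² N²
-- because 6 ≤ ε R.
clear-denominators : ∀ β ε N T R Q → 0ℚ <ℚ R → β *ℚ R ≡ Q → ι 6 ≤ℚ ε *ℚ R →
  R *ℚ Q *ℚ (N *ℚ N) ≤ℚ Q *ℚ Q *ℚ (N *ℚ N) +ℚ ι 4 *ℚ (R *ℚ R) *ℚ T +ℚ ι 6 *ℚ R *ℚ (N *ℚ N) →
  (β *ℚ (1ℚ -ℚ β) -ℚ ε) *ℚ (N *ℚ N *ℚ (+ 1 /ℚ 4)) ≤ℚ T
clear-denominators β ε N T R _ 0<R refl 6≤εR p =
  ℚ.*-cancelˡ-≤-pos (ι 4 *ℚ (R *ℚ R)) {{positive (0<* (ℚ.positive⁻¹ (ι 4)) (0<* 0<R 0<R))}}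
    (combineℚ (ℚ.+-mono-≤ p (*-monoˡ-≤ℚ (0≤* (ℚ.<⇒≤ 0<R) (square≥0 N)) 6≤εR))
      (ℚ.≤-reflexive (solve 5 (λ β ε N T R →
        con (ι 4) :* (R :* R) :* ((β :* (con 1ℚ :- β) :- ε) :* (N :* N :* con (+ 1 /ℚ 4)))
          :+ (β :* R :* (β :* R) :* (N :* N) :+ con (ι 4) :* (R :* R) :* T :+ con (ι 6) :* R :* (N :* N) :+ R :* (N :* N) :* (ε :* R))
        := con (ι 4) :* (R :* R) :* T :+ (R :* (β :* R) :* (N :* N) :+ R :* (N :* N) :* con (ι 6)))
        refl β ε N T R)))
  where open +-*-Solver

clear-book-denominators : ∀ β N B R Q → 0ℚ ≤ℚ R → β *ℚ R ≡ Q → B ≤ℚ (1ℚ -ℚ β) *ℚ (N *ℚ ½) →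
  ι 2 *ℚ (B *ℚ R) +ℚ Q *ℚ N ≤ℚ R *ℚ N
clear-book-denominators β N B R _ 0≤R refl B≤ = combineℚ (*-monoˡ-≤ℚ (0≤* (0≤ι 2) 0≤R) B≤)
  (ℚ.≤-reflexive (solve 4 (λ β N B R →
    con (ι 2) :* (B :* R) :+ β :* R :* N :+ con (ι 2) :* R :* ((con 1ℚ :- β) :* (N :* con ½))
      := R :* N :+ con (ι 2) :* R :* B) refl β N B R))
  where open +-*-Solver

ι-key : ∀ P r n t → ι (r * P * (n * n)) ≤ℚ ι (P * P * (n * n) + 4 * (r * r) * t + 6 * r * (n * n)) →
  ι r *ℚ ι P *ℚ (ι n *ℚ ι n) ≤ℚ
  ι P *ℚ ι P *ℚ (ι n *ℚ ι n) +ℚ ι 4 *ℚ (ι r *ℚ ι r) *ℚ ι t +ℚ ι 6 *ℚ ι r *ℚ (ι n *ℚ ι n)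
ι-key P r n t = subst₂ _≤ℚ_ (triple r P n n) (begin
  ι (P * P * (n * n) + 4 * (r * r) * t + 6 * r * (n * n))
    ≡⟨ ι-+ (P * P * (n * n) + 4 * (r * r) * t) (6 * r * (n * n)) ⟩
  ι (P * P * (n * n) + 4 * (r * r) * t) +ℚ ι (6 * r * (n * n))
    ≡⟨ cong₂ _+ℚ_ (ι-+ (P * P * (n * n)) (4 * (r * r) * t)) (triple 6 r n n) ⟩
  ι (P * P * (n * n)) +ℚ ι (4 * (r * r) * t) +ℚ ι 6 *ℚ ι r *ℚ (ι n *ℚ ι n)
    ≡⟨ cong (_+ℚ ι 6 *ℚ ι r *ℚ (ι n *ℚ ι n)) (cong₂ _+ℚ_ (triple P P n n) (ι-* (4 * (r * r)) t)) ⟩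
  ι P *ℚ ι P *ℚ (ι n *ℚ ι n) +ℚ ι (4 * (r * r)) *ℚ ι t +ℚ ι 6 *ℚ ι r *ℚ (ι n *ℚ ι n)
    ≡⟨ cong (λ x → ι P *ℚ ι P *ℚ (ι n *ℚ ι n) +ℚ x *ℚ ι t +ℚ ι 6 *ℚ ι r *ℚ (ι n *ℚ ι n))
         (trans (ι-* 4 (r * r)) (cong (ι 4 *ℚ_) (ι-* r r))) ⟩
  ι P *ℚ ι P *ℚ (ι n *ℚ ι n) +ℚ ι 4 *ℚ (ι r *ℚ ι r) *ℚ ι t +ℚ ι 6 *ℚ ι r *ℚ (ι n *ℚ ι n) ∎)
  where
  open ≡-Reasoning
  triple : ∀ a b c d → ι (a * b * (c * d)) ≡ ι a *ℚ ι b *ℚ (ι c *ℚ ι d)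
  triple a b c d = trans (ι-* (a * b) (c * d)) (cong₂ _*ℚ_ (ι-* a b) (ι-* c d))

-- If 16 t ≥ n², the bound on β (1 - β) suffices; otherwise the counting argument applies with P / r
-- = β.
triangles-scaled : ∀ β ε P r → β *ℚ ι r ≡ ι P → ι 6 ≤ℚ ε *ℚ ι r → 0ℚ ≤ℚ ε → β ≤ℚ 1ℚ → 5 ≤ P →
  ∀ n → 4 * (r * r) < n → (G : Graph n) → n * n / 4 + 1 ≤ edgeCount G →
  ι (b G) ≤ℚ (1ℚ -ℚ β) *ℚ (ι n *ℚ ½) →
  (β *ℚ (1ℚ -ℚ β) -ℚ ε) *ℚ (ι n *ℚ ι n *ℚ (+ 1 /ℚ 4)) ≤ℚ ι (t G)
triangles-scaled β ε P r βr≡P 6≤εr 0≤ε β≤1 5≤P n n₀<n G edges≥ b≤ =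
  [ (λ n²≤16t → many-triangles-density β ε (ι n) (ι (t G)) 0≤ε
      (subst₂ _≤ℚ_ (ι-* n n) (ι-* 16 (t G)) (ι-mono (n * n) (16 * t G) n²≤16t)))
  , (λ 16t≤n² → clear-denominators β ε (ι n) (ι (t G)) (ι r) (ι P) (ℚ.positive⁻¹ (ι r) {{ι-pos r 0<r}}) βr≡P 6≤εr
      (ι-key P r n (t G)
        (ι-mono (r * P * (n * n)) (P * P * (n * n) + 4 * (r * r) * t G + 6 * r * (n * n))
          (triangles-discrete G P r 5≤P P≤r (<⇒≤ n₀<n) (≤-trans (s≤s z≤n) n₀<n) edges≥ 16t≤n² sparse))))
  ]′ (≤-total (n * n) (16 * t G))
  where
  open ℚ.≤-Reasoning

  P≤r : P ≤ r
  P≤r = ι-cancel P r (begin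
    ι P          ≡⟨ βr≡P ⟨
    β *ℚ ι r     ≡⟨ ℚ.*-comm β (ι r) ⟩
    ι r *ℚ β     ≤⟨ *-monoˡ-≤ℚ (0≤ι r) β≤1 ⟩
    ι r *ℚ 1ℚ    ≡⟨ ℚ.*-identityʳ (ι r) ⟩
    ι r          ∎)

  0<r : 0 < r
  0<r = ≤-trans (s≤s z≤n) (≤-trans 5≤P P≤r)

  sparse : 2 * (b G * r) + P * n ≤ r * n
  sparse = ι-cancel (2 * (b G * r) + P * n) (r * n) (begin
    ι (2 * (b G * r) + P * n)               ≡⟨ ι-+ (2 * (b G * r)) (P * n) ⟩
    ι (2 * (b G * r)) +ℚ ι (P * n)          ≡⟨ cong₂ _+ℚ_ (ι-* 2 (b G * r)) (ι-* P n) ⟩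
    ι 2 *ℚ ι (b G * r) +ℚ ι P *ℚ ι n        ≡⟨ cong (λ x → ι 2 *ℚ x +ℚ ι P *ℚ ι n) (ι-* (b G) r) ⟩
    ι 2 *ℚ (ι (b G) *ℚ ι r) +ℚ ι P *ℚ ι n   ≤⟨ clear-book-denominators β (ι n) (ι (b G)) (ι r) (ι P) (0≤ι r) βr≡P b≤ ⟩
    ι r *ℚ ι n                              ≡⟨ ι-* r n ⟨
    ι (r * n)                               ∎)

ratio-scale : ∀ β p q K → β *ℚ ι q ≡ ι p → β *ℚ ι (q * K) ≡ ι (p * K)
ratio-scale β p q K βq≡p = begin
  β *ℚ ι (q * K)       ≡⟨ cong (β *ℚ_) (ι-* q K) ⟩
  β *ℚ (ι q *ℚ ι K)    ≡⟨ ℚ.*-assoc β (ι q) (ι K) ⟨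
  β *ℚ ι q *ℚ ι K      ≡⟨ cong (_*ℚ ι K) βq≡p ⟩
  ι p *ℚ ι K           ≡⟨ ι-* p K ⟨
  ι (p * K)            ∎
  where open ≡-Reasoning

scaled≥6 : ∀ ε q e₁ e₂ → 0 < q → 0 < e₁ → ε *ℚ ι e₂ ≡ ι e₁ → ι 6 ≤ℚ ε *ℚ ι (q * (6 * e₂))
scaled≥6 ε q e₁ e₂ 0<q 0<e₁ εe₂≡e₁ = begin
  ι 6                           ≤⟨ ι-mono 6 (q * 6 * e₁) (*-mono-≤ (*-mono-≤ 0<q (≤-refl {6})) 0<e₁) ⟩
  ι (q * 6 * e₁)                ≡⟨ ι-* (q * 6) e₁ ⟩
  ι (q * 6) *ℚ ι e₁             ≡⟨ cong (ι (q * 6) *ℚ_) εe₂≡e₁ ⟨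
  ι (q * 6) *ℚ (ε *ℚ ι e₂)      ≡⟨ solve 3 (λ x y z → x :* (y :* z) := y :* (x :* z)) refl (ι (q * 6)) ε (ι e₂) ⟩
  ε *ℚ (ι (q * 6) *ℚ ι e₂)      ≡⟨ cong (ε *ℚ_) (ι-* (q * 6) e₂) ⟨
  ε *ℚ ι (q * 6 * e₂)           ≡⟨ cong (λ x → ε *ℚ ι x) (*-assoc q 6 e₂) ⟩
  ε *ℚ ι (q * (6 * e₂))         ∎
  where
  open ℚ.≤-Reasoning
  open +-*-Solver

-- Here `β` stands for 1 - α, a substitution that leaves α (1 - α) unchanged.
triangles-rational : ∀ β ε → 0ℚ <ℚ β → β ≤ℚ 1ℚ → 0ℚ <ℚ ε →
  ∃[ n₀ ] (∀ n → n₀ < n → (G : Graph n) → n * n / 4 + 1 ≤ edgeCount G →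
    ι (b G) ≤ℚ (1ℚ -ℚ β) *ℚ (ι n *ℚ ½) →
    (β *ℚ (1ℚ -ℚ β) -ℚ ε) *ℚ (ι n *ℚ ι n *ℚ (+ 1 /ℚ 4)) ≤ℚ ι (t G))
triangles-rational β ε 0<β β≤1 0<ε =
  let p , q , 0<p , 0<q , βq≡p     = as-ratio β 0<β
      e₁ , e₂ , 0<e₁ , 0<e₂ , εe₂≡e₁ = as-ratio ε 0<ε
      -- The common factor 6 e₂ keeps P / r = β while giving P ≥ 6 and ε r = 6 q e₁ ≥ 6.
      P = p * (6 * e₂)
      r = q * (6 * e₂)
  in 4 * (r * r) , triangles-scaled β ε P r (ratio-scale β p q (6 * e₂) βq≡p)
       (scaled≥6 ε q e₁ e₂ 0<q 0<e₁ εe₂≡e₁) (ℚ.<⇒≤ 0<ε) β≤1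
       (≤-trans (n≤1+n 5) (*-mono-≤ 0<p (*-mono-≤ (≤-refl {6}) 0<e₂)))

-- Passage from rational to real parameters

∣p-q∣≤⇒p≤q+ : ∀ {p q η} → ∣ p -ℚ q ∣ ≤ℚ η → p ≤ℚ q +ℚ η
∣p-q∣≤⇒p≤q+ {p} {q} {η} h = combineℚ (ℚ.≤-trans (p≤∣p∣ (p -ℚ q)) h)
  (ℚ.≤-reflexive (solve 3 (λ p q η → p :+ η := q :+ η :+ (p :- q)) refl p q η))
  where open +-*-Solver

-- x (1 − x) − a (1 − a) = (a − x) (x + a − 1) ≤ a − x.
perturb : ∀ x a e d S → 0ℚ ≤ℚ S → x ≤ℚ a → a ≤ℚ x +ℚ ½ *ℚ d → x ≤ℚ 1ℚ → a ≤ℚ 1ℚ → d ≤ℚ e →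
  (x *ℚ (1ℚ +ℚ -ℚ x) +ℚ -ℚ e) *ℚ S +ℚ (+ 1 /ℚ 4) *ℚ d *ℚ S ≤ℚ
  ((1ℚ -ℚ a) *ℚ (1ℚ -ℚ (1ℚ -ℚ a)) -ℚ (+ 1 /ℚ 4) *ℚ d) *ℚ S
perturb x a e d S 0≤S x≤a a≤x+½d x≤1 a≤1 d≤e = begin
  (x *ℚ (1ℚ +ℚ -ℚ x) +ℚ -ℚ e) *ℚ S +ℚ (+ 1 /ℚ 4) *ℚ d *ℚ S
    ≡⟨ solve 4 (λ x e d S → (x :* (con 1ℚ :+ (:- x)) :+ (:- e)) :* S :+ con (+ 1 /ℚ 4) :* d :* S
                         := S :* (x :* (con 1ℚ :- x) :- e :+ con (+ 1 /ℚ 4) :* d)) refl x e d S ⟩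
  S *ℚ (x *ℚ (1ℚ -ℚ x) -ℚ e +ℚ (+ 1 /ℚ 4) *ℚ d)
    ≤⟨ *-monoˡ-≤ℚ 0≤S (combineℚ
         (ℚ.+-mono-≤ (0≤* (0≤-ℚ x≤a) (ℚ.+-mono-≤ (0≤-ℚ x≤1) (0≤-ℚ a≤1))) (ℚ.+-mono-≤ a≤x+½d d≤e))
         (ℚ.≤-reflexive (solve 4 (λ x a e d →
           x :* (con 1ℚ :- x) :- e :+ con (+ 1 /ℚ 4) :* d
             :+ ((a :- x) :* ((con 1ℚ :- x) :+ (con 1ℚ :- a)) :+ (x :+ con ½ :* d :+ e))
           := (con 1ℚ :- a) :* (con 1ℚ :- (con 1ℚ :- a)) :- con (+ 1 /ℚ 4) :* d
             :+ (con 0ℚ :+ (a :+ d))) refl x a e d))) ⟩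
  S *ℚ ((1ℚ -ℚ a) *ℚ (1ℚ -ℚ (1ℚ -ℚ a)) -ℚ (+ 1 /ℚ 4) *ℚ d)
    ≡⟨ ℚ.*-comm S _ ⟩
  ((1ℚ -ℚ a) *ℚ (1ℚ -ℚ (1ℚ -ℚ a)) -ℚ (+ 1 /ℚ 4) *ℚ d) *ℚ S ∎
  where
  open ℚ.≤-Reasoning
  open +-*-Solver
  0≤-ℚ : ∀ {p q} → p ≤ℚ q → 0ℚ ≤ℚ q -ℚ p
  0≤-ℚ {p} {q} p≤q = combineℚ p≤q
    (ℚ.≤-reflexive (solve 2 (λ p q → con 0ℚ :+ q := q :- p :+ p) refl p q))

0<⊓ : ∀ p q → 0ℚ <ℚ p → 0ℚ <ℚ q → 0ℚ <ℚ p ⊓ q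
0<⊓ p q 0<p 0<q with ℚ.⊓-sel p q
... | inj₁ eq = subst (0ℚ <ℚ_) (sym eq) 0<p
... | inj₂ eq = subst (0ℚ <ℚ_) (sym eq) 0<q

theorem1 : ∀ (α ε : ℝ) → fromℚ ½ <ℝ α → α <ℝ fromℚ 1ℚ → fromℚ 0ℚ <ℝ ε →
    ∃[ n₀ ] (∀ n → n₀ < n → (G : Graph n) →
    (n * n) / 4 + 1 ≤ edgeCount G →
    fromℕ (b G) <ℝ α *ℝ fromℚ (+ n /ℚ 2) →
    fromℕ (t G) >ℝ (α *ℝ (fromℚ 1ℚ -ℝ α) -ℝ ε) *ℝ fromℚ (+ (n * n) /ℚ 4))
theorem1 α ε (δ₁ , 0<δ₁ , N₁ , ½<α) (δ₂ , 0<δ₂ , N₂ , α<1) (d , 0<d , N₃ , 0<ε) =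
  proj₁ rational , λ n n₀<n G edges≥ (δ₄ , 0<δ₄ , N₄ , b<) →
    -- From some index on, ε is at least d: ½ d of it pays for replacing α by `a`, ¼ d for the
    -- rational error, and ¼ d for this gap.
    (+ 1 /ℚ 4) *ℚ d *ℚ S n ,
    0<* (0<* (ℚ.positive⁻¹ (+ 1 /ℚ 4)) 0<d)
        (0<* (0<* (0<ι n (≤-trans (s≤s z≤n) n₀<n)) (0<ι n (≤-trans (s≤s z≤n) n₀<n))) (ℚ.positive⁻¹ (+ 1 /ℚ 4))) ,
    M , λ i M≤i → ℚ.≤-trans
      (subst (λ s → (seq α i *ℚ (1ℚ +ℚ -ℚ seq α i) +ℚ -ℚ seq ε i) *ℚ s +ℚ (+ 1 /ℚ 4) *ℚ d *ℚ S n ≤ℚ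
                    ((1ℚ -ℚ a) *ℚ (1ℚ -ℚ (1ℚ -ℚ a)) -ℚ (+ 1 /ℚ 4) *ℚ d) *ℚ S n)
        (sym (trans (/-split (n * n) 3) (cong (_*ℚ (+ 1 /ℚ 4)) (ι-* n n))))
        (perturb (seq α i) a (seq ε i) d (S n) (0≤* (square≥0 (ι n)) (ℚ.<⇒≤ (ℚ.positive⁻¹ (+ 1 /ℚ 4))))
          (α≤a i M≤i) (a≤α i M≤i) (α≤1 i M≤i) a≤1 (d≤ε i M≤i)))
      (proj₂ rational n n₀<n G edges≥ (book n G δ₄ 0<δ₄ N₄ b<))
  where
  open +-*-Solver
  S : ℕ → ℚ
  S n = ι n *ℚ ι n *ℚ (+ 1 /ℚ 4)

  0<ι : ∀ n → 0 < n → 0ℚ <ℚ ι n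
  0<ι n 0<n = ℚ.positive⁻¹ (ι n) {{ι-pos n 0<n}}

  η : ℚ
  -- Two errors of at most ¼ d keep `a` within ½ d of α; the bound ½ δ₂ keeps `a` at distance ½ δ₂
  -- below 1.
  η = ((+ 1 /ℚ 4) *ℚ d) ⊓ (½ *ℚ δ₂)

  0<η : 0ℚ <ℚ η
  0<η = 0<⊓ ((+ 1 /ℚ 4) *ℚ d) (½ *ℚ δ₂) (0<* (ℚ.positive⁻¹ (+ 1 /ℚ 4)) 0<d) (0<* (ℚ.positive⁻¹ ½) 0<δ₂)

  N₅ M : ℕ
  N₅ = proj₁ (cauchy α η 0<η)
  M  = (N₁ ⊔ N₂) ⊔ (N₃ ⊔ N₅)

  -- An upper bound for the sequence of α from M on, so that b(G) < α n / 2 gives b(G) ≤ a n / 2.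
  a : ℚ
  a = seq α M +ℚ η

  N₁≤M : N₁ ≤ M
  N₁≤M = ≤-trans (m≤m⊔n N₁ N₂) (m≤m⊔n (N₁ ⊔ N₂) (N₃ ⊔ N₅))

  N₂≤M : N₂ ≤ M
  N₂≤M = ≤-trans (m≤n⊔m N₁ N₂) (m≤m⊔n (N₁ ⊔ N₂) (N₃ ⊔ N₅))

  N₃≤M : N₃ ≤ M
  N₃≤M = ≤-trans (m≤m⊔n N₃ N₅) (m≤n⊔m (N₁ ⊔ N₂) (N₃ ⊔ N₅))

  N₅≤M : N₅ ≤ M
  N₅≤M = ≤-trans (m≤n⊔m N₃ N₅) (m≤n⊔m (N₁ ⊔ N₂) (N₃ ⊔ N₅))

  α≤a : ∀ i → M ≤ i → seq α i ≤ℚ a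
  α≤a i M≤i = ∣p-q∣≤⇒p≤q+ (ℚ.<⇒≤ (proj₂ (cauchy α η 0<η) i M (≤-trans N₅≤M M≤i) N₅≤M))

  a≤α : ∀ i → M ≤ i → a ≤ℚ seq α i +ℚ ½ *ℚ d
  a≤α i M≤i = combineℚ
    (ℚ.+-mono-≤ (∣p-q∣≤⇒p≤q+ {seq α M} {seq α i} (ℚ.<⇒≤ (proj₂ (cauchy α η 0<η) M i N₅≤M (≤-trans N₅≤M M≤i))))
                (ℚ.+-mono-≤ η≤¼d η≤¼d))
    (ℚ.≤-reflexive (solve 4 (λ m x η d → m :+ η :+ (x :+ η :+ (con (+ 1 /ℚ 4) :* d :+ con (+ 1 /ℚ 4) :* d))
                                   := x :+ con ½ :* d :+ (m :+ (η :+ η))) refl (seq α M) (seq α i) η d))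
    where
    η≤¼d : η ≤ℚ (+ 1 /ℚ 4) *ℚ d
    η≤¼d = ℚ.p⊓q≤p ((+ 1 /ℚ 4) *ℚ d) (½ *ℚ δ₂)

  a+½δ₂≤1 : a +ℚ ½ *ℚ δ₂ ≤ℚ 1ℚ
  a+½δ₂≤1 = combineℚ (ℚ.+-mono-≤ (α<1 M N₂≤M) (ℚ.p⊓q≤q ((+ 1 /ℚ 4) *ℚ d) (½ *ℚ δ₂)))
    (ℚ.≤-reflexive (solve 3 (λ m η e → m :+ η :+ con ½ :* e :+ (con 1ℚ :+ con ½ :* e) := con 1ℚ :+ (m :+ e :+ η))
      refl (seq α M) η δ₂))

  α≤1 : ∀ i → M ≤ i → seq α i ≤ℚ 1ℚ
  α≤1 i M≤i = combineℚ (ℚ.+-mono-≤ (α<1 i (≤-trans N₂≤M M≤i)) (ℚ.<⇒≤ 0<δ₂))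
    (ℚ.≤-reflexive (solve 2 (λ x e → x :+ (con 1ℚ :+ e) := con 1ℚ :+ (x :+ e :+ con 0ℚ)) refl (seq α i) δ₂))

  a≤1 : a ≤ℚ 1ℚ
  a≤1 = combineℚ (ℚ.+-mono-≤ a+½δ₂≤1 (ℚ.<⇒≤ (0<* (ℚ.positive⁻¹ ½) 0<δ₂)))
    (ℚ.≤-reflexive (solve 2 (λ x e → x :+ (con 1ℚ :+ e) := con 1ℚ :+ (x :+ e :+ con 0ℚ)) refl a (½ *ℚ δ₂)))

  0<1-a : 0ℚ <ℚ 1ℚ -ℚ a
  0<1-a = ℚ.<-≤-trans (0<* (ℚ.positive⁻¹ ½) 0<δ₂) (combineℚ a+½δ₂≤1
    (ℚ.≤-reflexive (solve 2 (λ x e → e :+ con 1ℚ := con 1ℚ :- x :+ (x :+ e)) refl a (½ *ℚ δ₂))))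

  1-a≤1 : 1ℚ -ℚ a ≤ℚ 1ℚ
  1-a≤1 = combineℚ (ℚ.+-mono-≤ (½<α M N₁≤M) (ℚ.+-mono-≤ (ℚ.<⇒≤ 0<η) (ℚ.+-mono-≤ (ℚ.<⇒≤ 0<δ₁) (ℚ.<⇒≤ (ℚ.positive⁻¹ ½)))))
    (ℚ.≤-reflexive (solve 3 (λ m η e → con 1ℚ :- (m :+ η) :+ (m :+ (η :+ (e :+ con ½)))
                                   := con 1ℚ :+ (con ½ :+ e :+ (con 0ℚ :+ (con 0ℚ :+ con 0ℚ)))) refl (seq α M) η δ₁))

  d≤ε : ∀ i → M ≤ i → d ≤ℚ seq ε i
  d≤ε i M≤i = subst (_≤ℚ seq ε i) (ℚ.+-identityˡ d) (0<ε i (≤-trans N₃≤M M≤i))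

  rational = triangles-rational (1ℚ -ℚ a) ((+ 1 /ℚ 4) *ℚ d) 0<1-a 1-a≤1 (0<* (ℚ.positive⁻¹ (+ 1 /ℚ 4)) 0<d)

  book : ∀ n (G : Graph n) δ₄ → 0ℚ <ℚ δ₄ → ∀ N₄ →
    (∀ i → N₄ ≤ i → ι (b G) +ℚ δ₄ ≤ℚ seq α i *ℚ (+ n /ℚ 2)) →
    ι (b G) ≤ℚ (1ℚ -ℚ (1ℚ -ℚ a)) *ℚ (ι n *ℚ ½)
  book n G δ₄ 0<δ₄ N₄ b< = begin
    ι (b G)                                ≡⟨ ℚ.+-identityʳ (ι (b G)) ⟨
    ι (b G) +ℚ 0ℚ                          ≤⟨ ℚ.+-monoʳ-≤ (ι (b G)) (ℚ.<⇒≤ 0<δ₄) ⟩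
    ι (b G) +ℚ δ₄                          ≤⟨ b< i (m≤m⊔n N₄ M) ⟩
    seq α i *ℚ (+ n /ℚ 2)                  ≡⟨ cong (seq α i *ℚ_) (/-split n 1) ⟩
    seq α i *ℚ (ι n *ℚ ½)                  ≡⟨ ℚ.*-comm (seq α i) (ι n *ℚ ½) ⟩
    ι n *ℚ ½ *ℚ seq α i                    ≤⟨ *-monoˡ-≤ℚ (0≤* (0≤ι n) (ℚ.<⇒≤ (ℚ.positive⁻¹ ½))) (α≤a i (m≤n⊔m N₄ M)) ⟩
    ι n *ℚ ½ *ℚ a
      ≡⟨ solve 2 (λ m a → m :* a := (con 1ℚ :- (con 1ℚ :- a)) :* m) refl (ι n *ℚ ½) a ⟩
    (1ℚ -ℚ (1ℚ -ℚ a)) *ℚ (ι n *ℚ ½)        ∎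
    where
    open ℚ.≤-Reasoning
    -- An index late enough for both the book hypothesis and α ≤ a.
    i = N₄ ⊔ M
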